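{- Let $H_1,\ldots,H_k$ be non-bipartite graphs and $r^*:=r^*(H_1,\ldots,H_k)$. For every $\varepsilon>0$ there exists $\delta>0$ such that the following holds for all sufficiently large $n$: if a colouring $\phi:\binom{[n]}{2}\to[k]$ satisfies $$\mathrm{nim}(\phi;H_1,\ldots,H_k)\ge \left(1-\frac1{r^*}\right)\frac{n^2}{2}-\delta n^2,$$ then $\delta_{\mathrm{edit}}(G^{\mathrm{nim}},T(n,r^*))\le\varepsilon n^2$, where $G^{\mathrm{nim}}$ is the spanning subgraph of $K_n$ on $[n]$ whose edges are the NIM-edges of $\phi$.
   Context: For a $k$-edge-colouring $\phi$ of $K_n$, an edge is a NIM-edge if for no $i\in[k]$ it is contained in a copy of $H_i$ all of whose edges have colour $i$; $\mathrm{nim}(\phi;H_1,\ldots,H_k)$ is the number of NIM-edges. A colouring $\xi:\binom{[r]}{\le 2}\to[k]$ (on subsets of $[r]$ of size at most 2) is feasible if (P1) for each $i\in[k]$ there is no homomorphism from $H_i$ to the graph on $[r]$ formed by the pairs of $\xi$-colour $i$, and (P2) $\xi(\{a,b\})\ne\xi(\{a\})$ for all distinct $a,b\in[r]$; $r^*(H_1,\ldots,H_k)$ is the largest $r$ admitting a feasible colouring. $T(n,r)$ is the Turán graph. The edit distance $\delta_{\mathrm{edit}}(G,H)$ between graphs of the same order is $\min_\sigma|E(G)\triangle\sigma(E(H))|$ over bijections $\sigma:V(H)\to V(G)$. -}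

module Defs where

open import Data.Nat using (ℕ; zero; suc; _%_)
open import Data.Bool using (Bool; true; false; if_then_else_; _∧_; _xor_)
open import Data.Bool.Properties using () renaming (_≟_ to _≟B_)
open import Data.Fin using (Fin; toℕ; _<?_)
import Data.Fin as F
open import Data.Fin.Properties using (any?; all?) renaming (_≟_ to _≟F_)
open import Data.Vec using (Vec; []; _∷_; lookup)
open import Data.List using (List; concatMap; allFin; [_])
open import Data.Nat.ListAction using (sum)
open import Data.Product using (Σ; ∃; _×_; _,_)
open import Relation.Binary.PropositionalEquality using (_≡_; _≢_)
open import Relation.Nullary using (¬_; Dec; yes; no; does)
open import Relation.Nullary.Decidable using (¬?; _×-dec_; _→-dec_; map′)
open import Data.Nat using (_≡ᵇ_)

record Graph : Set where
  field
    size   : ℕ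
    adj    : Fin size → Fin size → Bool
    sym    : ∀ a b → adj a b ≡ adj b a
    irrefl : ∀ a → adj a a ≡ false
open Graph public

Bipartite : Graph → Set
Bipartite H = Σ (Fin (size H) → Bool) λ c →
  ∀ a b → adj H a b ≡ true → c a ≢ c b

NonBipartite : Graph → Set
NonBipartite H = ¬ Bipartite H

-- Feasible colourings ξ of subsets of [r] of size 1 and 2 with k colours.
-- ξ₁ a     = ξ({a}),   ξ₂ a b = ξ({a,b}) for a ≠ b (ξ₂ symmetric;
-- diagonal values unused).

HomToColourClass : ∀ {k r} → Graph → (Fin r → Fin r → Fin k) → Fin k → Set
HomToColourClass {k} {r} H ξ₂ i = Σ (Fin (size H) → Fin r) λ f →
  ∀ a b → adj H a b ≡ true → (f a ≢ f b) × (ξ₂ (f a) (f b) ≡ i)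

Feasible : ∀ {k} → (Fin k → Graph) → ℕ → Set
Feasible {k} Hs r =
  Σ (Fin r → Fin k) λ ξ₁ → Σ (Fin r → Fin r → Fin k) λ ξ₂ →
    (∀ a b → ξ₂ a b ≡ ξ₂ b a)
  × (∀ i → ¬ HomToColourClass (Hs i) ξ₂ i)
  × (∀ a b → a ≢ b → ξ₂ a b ≢ ξ₁ a)

IsRStar : ∀ {k} → (Fin k → Graph) → ℕ → Set
IsRStar Hs r = Feasible Hs r × (∀ r′ → Feasible Hs r′ → r′ Data.Nat.≤ r)

-- Edge-colourings of K_n: φ u v = colour of {u,v} (φ symmetric,
-- diagonal unused).

-- A copy of H in K_n is given by an injective map Fin (size H) → Fin n,
-- encoded as the vector of images of the vertices of H.
Injectiveᵛ : ∀ {m n} → Vec (Fin n) m → Set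
Injectiveᵛ v = ∀ a b → lookup v a ≡ lookup v b → a ≡ b

InMonoCopy : ∀ {k n} → (Fin n → Fin n → Fin k) → Graph → Fin k
           → Fin n → Fin n → Set
InMonoCopy {k} {n} φ H i u w = Σ (Vec (Fin n) (size H)) λ v →
    Injectiveᵛ v
  × (∀ a b → adj H a b ≡ true → φ (lookup v a) (lookup v b) ≡ i)
  × (∃ λ a → ∃ λ b → (adj H a b ≡ true) × (lookup v a ≡ u) × (lookup v b ≡ w))

IsNIM : ∀ {k n} → (Fin k → Graph) → (Fin n → Fin n → Fin k)
      → Fin n → Fin n → Set
IsNIM Hs φ u w = ∀ i → ¬ InMonoCopy φ (Hs i) i u w

anyVec? : ∀ {n} m (P : Vec (Fin n) m → Set) → (∀ v → Dec (P v))
        → Dec (Σ (Vec (Fin n) m) P)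
anyVec? zero P P? with P? []
... | yes p = yes ([] , p)
... | no ¬p = no λ { ([] , p) → ¬p p }
anyVec? (suc m) P P? =
  map′ (λ { (x , v , p) → (x ∷ v) , p })
       (λ { ((x ∷ v) , p) → x , v , p })
       (any? λ x → anyVec? m (λ v → P (x ∷ v)) (λ v → P? (x ∷ v)))

inMonoCopy? : ∀ {k n} φ H i u w → Dec (InMonoCopy {k} {n} φ H i u w)
inMonoCopy? φ H i u w = anyVec? (size H) _ λ v →
  (all? λ a → all? λ b → (lookup v a ≟F lookup v b) →-dec (a ≟F b))
  ×-dec (all? λ a → all? λ b → (adj H a b ≟B true) →-dec (φ (lookup v a) (lookup v b) ≟F i))
  ×-dec (any? λ a → any? λ b → (adj H a b ≟B true) ×-dec ((lookup v a ≟F u) ×-dec (lookup v b ≟F w)))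

isNIM? : ∀ {k n} Hs φ u w → Dec (IsNIM {k} {n} Hs φ u w)
isNIM? Hs φ u w = all? λ i → ¬? (inMonoCopy? φ (Hs i) i u w)

countPairs : (n : ℕ) → (Fin n → Fin n → Bool) → ℕ
countPairs n b = sum (concatMap (λ u → concatMap (λ w →
  [ (if does (u <? w) ∧ b u w then 1 else 0) ]) (allFin n)) (allFin n))

nim : ∀ {k} n → (Fin k → Graph) → (Fin n → Fin n → Fin k) → ℕ
nim n Hs φ = countPairs n λ u w → does (isNIM? Hs φ u w)

-- Turán graph T(n,r): vertex v in part (toℕ v mod r); parts have sizes
-- ⌊n/r⌋ or ⌈n/r⌉; adjacency = different parts.  (r = 0 never occurs
-- for r = r*, since r* ≥ 1 whenever k ≥ 1.)
turanPart : (r : ℕ) → ℕ → ℕ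
turanPart zero    x = 0
turanPart (suc r) x = x % suc r

turanAdj : ∀ n (r : ℕ) → Fin n → Fin n → Bool
turanAdj n r a b = Data.Bool.not (turanPart r (toℕ a) ≡ᵇ turanPart r (toℕ b))

-- |E(G^nim) △ σ(E(T(n,r)))| for a bijection σ : V(T) → V(G^nim)
-- (counted over unordered pairs {a,b} of V(T), i.e. over pairs
--  {σ a, σ b} of V(G^nim))
nimTuranDiff : ∀ {k} n r → (Fin k → Graph) → (Fin n → Fin n → Fin k)
             → (Fin n → Fin n) → ℕ
nimTuranDiff n r Hs φ σ = countPairs n λ a b →
  does (isNIM? Hs φ (σ a) (σ b)) xor turanAdj n r a b

open import Data.Integer using (+_)
import Data.Rational as Q

ℕ→ℚ : ℕ → Q.ℚ
ℕ→ℚ m = (+ m) Q./ 1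

oneMinusInv : ℕ → Q.ℚ
oneMinusInv zero    = Q.0ℚ
oneMinusInv (suc r) = Q.1ℚ Q.- ((+ 1) Q./ suc r)

{-# OPTIONS --safe #-}

-- A large blow-up of K_{r+1} in the NIM-graph, with r = r*, would give a feasible colouring of [r + 1]: by
-- Ramsey's theorem one may shrink its parts until each part and each pair of parts is monochromatic, and a
-- violation of (P1) or (P2) by these colours produces a monochromatic copy of some Hᵢ through a NIM-edge.
-- By Cauchy–Schwarz, a positive density of K_{r+1} forces such a blow-up, so the NIM-graph has few K_{r+1}.
-- Füredi's argument, run with a vertex of maximum degree among those lying in few cliques, then yields an
-- r-partition with e(G) + Σ e(Aᵢ) ≤ Σ_{i<j} |Aᵢ||Aⱼ| + o(n²). Together with the lower bound on e(G) this
-- makes the parts almost equal, the edges inside them few, and the missing edges between them few.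
-- Densities are kept as natural-number inequalities n ^ s ≤ C * count, sums run over ordered pairs, and δ
-- is the reciprocal of a natural number.

module Submission where

open import Defs hiding (sym)
open import Data.Bool using (Bool; true; false; if_then_else_; _∧_; not; _xor_)
import Data.Bool.Properties as Bool
open import Data.Fin using (Fin; zero; suc; toℕ; fromℕ<; combine; funToFin; finToFun; inject≤)
import Data.Fin as F
open import Data.Fin.Permutation as Perm using (Permutation; _⟨$⟩ʳ_; _∘ₚ_; transpose)
import Data.Fin.Properties as F
import Data.Integer as ℤ
import Data.Integer.Properties as ℤ
import Data.List as List
open import Data.Nat
open import Data.Nat.DivMod using (m<n⇒m%n≡m; [m+n]%n≡m%n; m%n<n)
open import Data.Nat.ListAction using () renaming (sum to listSum)
open import Data.Nat.ListAction.Properties using (sum-++)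
open import Data.Nat.Properties
open import Algebra.Properties.Semiring.Sum +-*-semiring
  using (sum; sum-cong-≗; ∑-distrib-+; ∑-comm; *-distribˡ-sum; *-distribʳ-sum; sum-permute)
open import Data.Nat.Tactic.RingSolver using (solve-∀)
open import Data.Product using (Σ; ∃; ∃₂; _×_; _,_; proj₁; proj₂)
open import Data.Rational using (ℚ; mkℚ; 0ℚ; 1ℚ; ½; fromℚᵘ; toℚᵘ)
import Data.Rational as ℚ
import Data.Rational.Properties as ℚ
open import Data.Rational.Solver using (module +-*-Solver)
open import Data.Rational.Unnormalised as ℚᵘ using (mkℚᵘ; *≡*; *≤*)
import Data.Rational.Unnormalised.Properties as ℚᵘ
open import Data.Sum using (_⊎_; inj₁; inj₂)
open import Data.Vec using (tabulate)
open import Data.Vec.Functional using (_∷_)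
open import Data.Vec.Properties using (lookup∘tabulate)
open import Function using (_∘_; id; mk⇔)
open import Function.Bundles using (Bijection)
open import Function.Definitions using (Injective; Bijective)
open import Function.Properties.Inverse using (↔⇒⤖)
open import Relation.Binary.Definitions using (tri<; tri≈; tri>)
open import Relation.Binary.PropositionalEquality hiding ([_])
open import Relation.Nullary using (¬_; Dec; yes; no; does; contradiction; ¬?; _×-dec_)
open import Relation.Nullary.Decidable using (decidable-stable; does-⇔)

-- Füredi's inequality carries the surplus `Σ e(Aᵢ)` because the degrees summed over a class count
-- its inner edges twice. In the exact argument the neighbourhood of a maximum-degree vertex
-- contains no smaller clique; here it is only poor in them, and only if the vertex itself lies in
-- few cliques. By Markov's inequality at most `n / 4K` vertices lie in many, and charging each of
-- them degree `n` costs `O(n² / K)`.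
--
-- The edit distance asks for a bijection onto the residue classes mod `r`. It is found by local
-- search: swap two misplaced vertices as long as one of them becomes well placed. When no swap is
-- left, every class contains or is contained in its Turán class, so the misplaced vertices are
-- counted by differences of class sizes. These are controlled only through their squares, which is
-- why accuracy `1 / L` needs a density error of order `1 / L²`.

𝟙 : Bool → ℕ
𝟙 b = if b then 1 else 0

-- Finite sums of natural numbers

2ab≤a²+b² : ∀ a b → 2 * (a * b) ≤ a * a + b * b
2ab≤a²+b² a b with ≤-total a b
... | inj₁ a≤b with d , refl ← m≤n⇒∃[o]m+o≡n a≤b =
  ≤-trans (m≤m+n _ (d * d)) (≤-reflexive (eq a d))
  where
  eq : ∀ a d → 2 * (a * (a + d)) + d * d ≡ a * a + (a + d) * (a + d)
  eq = solve-∀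
... | inj₂ b≤a with d , refl ← m≤n⇒∃[o]m+o≡n b≤a =
  ≤-trans (m≤m+n _ (d * d)) (≤-reflexive (eq b d))
  where
  eq : ∀ b d → 2 * ((b + d) * b) + d * d ≡ (b + d) * (b + d) + b * b
  eq = solve-∀

-- Abstract, so that the unifier treats ∑ as injective and infers the number of terms.
abstract
  ∑ : ∀ {n} → (Fin n → ℕ) → ℕ
  ∑ = sum

∑-syntax : ∀ n → (Fin n → ℕ) → ℕ
∑-syntax n f = ∑ f

infixl 10 ∑-syntax
syntax ∑-syntax n (λ i → x) = ∑[ i < n ] x

abstract
  ∑-suc : ∀ {n} (f : Fin (suc n) → ℕ) → ∑ f ≡ f zero + ∑ (f ∘ suc)
  ∑-suc f = refl

  ∑-empty : (f : Fin 0 → ℕ) → ∑ f ≡ 0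
  ∑-empty f = refl

  ∑-cong : ∀ {n} {f g : Fin n → ℕ} → (∀ i → f i ≡ g i) → ∑ f ≡ ∑ g
  ∑-cong = sum-cong-≗

  ∑-+ : ∀ {n} (f g : Fin n → ℕ) → ∑[ i < n ] (f i + g i) ≡ ∑ f + ∑ g
  ∑-+ = ∑-distrib-+

  ∑-swap : ∀ {m n} (f : Fin m → Fin n → ℕ) →
    ∑[ i < m ] ∑[ j < n ] f i j ≡ ∑[ j < n ] ∑[ i < m ] f i j
  ∑-swap = ∑-comm

  ∑-*ˡ : ∀ {n} c (f : Fin n → ℕ) → c * ∑ f ≡ ∑[ i < n ] (c * f i)
  ∑-*ˡ = *-distribˡ-sum

  ∑-*ʳ : ∀ {n} c (f : Fin n → ℕ) → ∑ f * c ≡ ∑[ i < n ] (f i * c)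
  ∑-*ʳ = *-distribʳ-sum

  ∑-permute : ∀ {n} (f : Fin n → ℕ) (π : Permutation n n) → ∑ f ≡ ∑[ i < n ] f (π ⟨$⟩ʳ i)
  ∑-permute = sum-permute

  ∑-mono : ∀ {n} {f g : Fin n → ℕ} → (∀ i → f i ≤ g i) → ∑ f ≤ ∑ g
  ∑-mono {zero}  f≤g = z≤n
  ∑-mono {suc n} f≤g = +-mono-≤ (f≤g zero) (∑-mono (f≤g ∘ suc))

  ∑-mono-< : ∀ {n} {f g : Fin n → ℕ} → (∀ i → f i ≤ g i) → ∀ i → f i < g i → ∑ f < ∑ g
  ∑-mono-< f≤g zero    f<g = +-mono-<-≤ f<g (∑-mono (f≤g ∘ suc))
  ∑-mono-< f≤g (suc i) f<g = +-mono-≤-< (f≤g zero) (∑-mono-< (f≤g ∘ suc) i f<g)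

  ∑-const : ∀ n c → ∑[ i < n ] c ≡ n * c
  ∑-const zero    c = refl
  ∑-const (suc n) c = cong (c +_) (∑-const n c)

  term≤∑ : ∀ {n} (f : Fin n → ℕ) i → f i ≤ ∑ f
  term≤∑ f zero    = m≤m+n _ _
  term≤∑ f (suc i) = ≤-trans (term≤∑ (f ∘ suc) i) (m≤n+m _ _)

  ∑-average : ∀ {n} → 1 ≤ n → (f : Fin n → ℕ) → ∀ b → n * b ≤ ∑ f → ∃ λ i → b ≤ f i
  ∑-average {suc n} _ f b h with b ≤? f zero
  ... | yes p = zero , p
  ∑-average {suc zero} _ f b h | no ¬p = contradiction (≤-trans (≤-reflexive (sym (+-identityʳ b)))
                                           (≤-trans h (≤-reflexive (+-identityʳ _)))) ¬p
  ∑-average {suc (suc n)} _ f b h | no ¬p =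
    let i , q = ∑-average (s≤s z≤n) (f ∘ suc) b (+-cancelˡ-≤ b _ _
                  (≤-trans h (+-monoˡ-≤ _ (<⇒≤ (≰⇒> ¬p)))))
    in suc i , q

-- Cauchy-Schwarz against the constant vector, by induction: the cross term `2 a S` is bounded term
-- by term by the inequality between arithmetic and geometric means.
∑-square : ∀ {n} (f : Fin n → ℕ) → ∑ f * ∑ f ≤ n * ∑[ i < n ] (f i * f i)
∑-square {zero}  f = ≤-trans (≤-reflexive (cong (λ t → t * t) (∑-empty f))) z≤n
∑-square {suc n} f = begin
  ∑ f * ∑ f                                  ≡⟨ cong (λ t → t * t) (∑-suc f) ⟩
  (a + S) * (a + S)                          ≡⟨ eq₁ a S ⟩
  a * a + (2 * a) * S + S * S                ≤⟨ +-mono-≤ (+-monoʳ-≤ (a * a) cross) (∑-square (f ∘ suc)) ⟩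
  a * a + (n * (a * a) + Q) + n * Q          ≡⟨ eq₂ n (a * a) Q ⟩
  suc n * (a * a + Q)                        ≡⟨ cong (suc n *_) (∑-suc (λ i → f i * f i)) ⟨
  suc n * ∑[ i < suc n ] (f i * f i)         ∎
  where
  open ≤-Reasoning
  a = f zero
  S = ∑ (f ∘ suc)
  Q = ∑[ i < n ] (f (suc i) * f (suc i))
  eq₁ : ∀ a S → (a + S) * (a + S) ≡ a * a + (2 * a) * S + S * S
  eq₁ = solve-∀
  eq₂ : ∀ n x Q → x + (n * x + Q) + n * Q ≡ (1 + n) * (x + Q)
  eq₂ = solve-∀
  cross : (2 * a) * S ≤ n * (a * a) + Q
  cross = begin
    (2 * a) * S                                  ≡⟨ ∑-*ˡ (2 * a) (f ∘ suc) ⟩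
    ∑[ i < n ] ((2 * a) * f (suc i))             ≤⟨ ∑-mono (λ i → ≤-trans (≤-reflexive (*-assoc 2 a _)) (2ab≤a²+b² a (f (suc i)))) ⟩
    ∑[ i < n ] (a * a + f (suc i) * f (suc i))   ≡⟨ ∑-+ (λ _ → a * a) (λ i → f (suc i) * f (suc i)) ⟩
    ∑[ i < n ] (a * a) + Q                       ≡⟨ cong (_+ Q) (∑-const n (a * a)) ⟩
    n * (a * a) + Q                              ∎

-- Vertex subsets and counts of ordered cliques

module _ {n : ℕ} where

  Subset : Set
  Subset = Fin n → Bool

  _∩_ : Subset → Subset → Subset
  (U ∩ V) x = U x ∧ V x

  _⊆_ : Subset → Subset → Set
  U ⊆ V = ∀ x → U x ≡ true → V x ≡ true

∧-true : ∀ a {b} → a ∧ b ≡ true → a ≡ true × b ≡ true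
∧-true true p = refl , p

𝟙-mono : ∀ {a b} → (a ≡ true → b ≡ true) → 𝟙 a ≤ 𝟙 b
𝟙-mono {false} h = z≤n
𝟙-mono {true}  h rewrite h refl = ≤-refl

𝟙≤1 : ∀ b → 𝟙 b ≤ 1
𝟙≤1 false = z≤n
𝟙≤1 true  = ≤-refl

𝟙-∧ : ∀ a b → 𝟙 (a ∧ b) ≡ 𝟙 a * 𝟙 b
𝟙-∧ false b = refl
𝟙-∧ true  b = sym (+-identityʳ _)

module Cliques {n : ℕ} (adj : Fin n → Fin n → Bool) where

  -- Ordered cliques: each `K_s` of a loopless graph inside `U` is counted `s!` times. Recursing
  -- into neighbourhoods avoids quantifying over tuples.
  cliques : ℕ → Subset {n} → ℕ
  cliques zero    U = 1
  cliques (suc s) U = ∑[ x < n ] (𝟙 (U x) * cliques s (U ∩ adj x))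

  cliques-mono : ∀ s {U V} → U ⊆ V → cliques s U ≤ cliques s V
  cliques-mono zero    U⊆V = ≤-refl
  cliques-mono (suc s) {U} {V} U⊆V = ∑-mono λ x →
    *-mono-≤ (𝟙-mono (U⊆V x)) (cliques-mono s λ y p →
      let q , r = ∧-true (U y) p in cong₂ _∧_ (U⊆V y q) r)

  cliques≤n^s : ∀ s U → cliques s U ≤ n ^ s
  cliques≤n^s zero    U = ≤-refl
  cliques≤n^s (suc s) U = ≤-trans
    (∑-mono λ x → ≤-trans (*-mono-≤ (𝟙≤1 (U x)) (cliques≤n^s s _)) (≤-reflexive (*-identityˡ _)))
    (≤-reflexive (∑-const n (n ^ s)))

  -- Cauchy–Schwarz over the s-tuples spanning cliques, coordinate by coordinate.
  cliques-cauchy-schwarz : ∀ s {m} (a : Fin m → ℕ) (W : Fin m → Subset) →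
    (∑[ x < m ] (a x * cliques s (W x))) * (∑[ x < m ] (a x * cliques s (W x)))
      ≤ n ^ s * ∑[ x < m ] ∑[ y < m ] ((a x * a y) * cliques s (W x ∩ W y))
  cliques-cauchy-schwarz zero {m} a W = ≤-reflexive (begin
    A * A                                         ≡⟨ ∑-*ʳ A (λ x → a x * 1) ⟩
    ∑[ x < m ] (a x * 1 * A)                      ≡⟨ ∑-cong (λ x → trans (∑-*ˡ (a x * 1) (λ y → a y * 1))
                                                       (∑-cong λ y → eq (a x) (a y))) ⟩
    ∑[ x < m ] ∑[ y < m ] ((a x * a y) * 1)       ≡⟨ *-identityˡ _ ⟨
    1 * ∑[ x < m ] ∑[ y < m ] ((a x * a y) * 1)   ∎)
    where
    open ≡-Reasoning
    A = ∑[ x < m ] (a x * 1)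
    eq : ∀ u v → u * 1 * (v * 1) ≡ (u * v) * 1
    eq = solve-∀
  cliques-cauchy-schwarz (suc s) {m} a W = begin
    L * L                                   ≡⟨ cong₂ _*_ swap swap ⟩
    ∑ g * ∑ g                           ≤⟨ ∑-square g ⟩
    n * ∑[ z < n ] (g z * g z)              ≤⟨ *-monoʳ-≤ n (∑-mono λ z →
                                                 cliques-cauchy-schwarz s (b z) (λ x → W x ∩ adj z)) ⟩
    n * ∑[ z < n ] (n ^ s * ∑[ x < m ] ∑[ y < m ] ((b z x * b z y) * cliques s ((W x ∩ adj z) ∩ (W y ∩ adj z))))
                                            ≡⟨ cong (n *_) (∑-*ˡ (n ^ s) _) ⟨
    n * (n ^ s * ∑[ z < n ] ∑[ x < m ] ∑[ y < m ] ((b z x * b z y) * cliques s ((W x ∩ adj z) ∩ (W y ∩ adj z))))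
                                            ≡⟨ *-assoc n (n ^ s) _ ⟨
    n ^ suc s * ∑[ z < n ] ∑[ x < m ] ∑[ y < m ] ((b z x * b z y) * cliques s ((W x ∩ adj z) ∩ (W y ∩ adj z)))
                                            ≤⟨ *-monoʳ-≤ (n ^ suc s) (∑-mono λ z → ∑-mono λ x → ∑-mono λ y → step z x y) ⟩
    n ^ suc s * ∑[ z < n ] ∑[ x < m ] ∑[ y < m ] h x y z
                                            ≡⟨ cong (n ^ suc s *_) (∑-swap (λ z x → ∑[ y < m ] h x y z)) ⟩
    n ^ suc s * ∑[ x < m ] ∑[ z < n ] ∑[ y < m ] h x y z
                                            ≡⟨ cong (n ^ suc s *_) (∑-cong λ x → trans (∑-swap (λ z y → h x y z))
                                                 (∑-cong λ y → sym (∑-*ˡ (a x * a y) _))) ⟩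
    n ^ suc s * ∑[ x < m ] ∑[ y < m ] ((a x * a y) * cliques (suc s) (W x ∩ W y)) ∎
    where
    open ≤-Reasoning
    L = ∑[ x < m ] (a x * cliques (suc s) (W x))
    -- For a fixed first clique vertex `z`, the condition that `z` lies in `W x` is absorbed into
    -- the weight. This is why the statement allows arbitrary weights `a`.
    b : Fin n → Fin m → ℕ
    b z x = a x * 𝟙 (W x z)
    g : Fin n → ℕ
    g z = ∑[ x < m ] (b z x * cliques s (W x ∩ adj z))
    h : Fin m → Fin m → Fin n → ℕ
    h x y z = (a x * a y) * (𝟙 (W x z ∧ W y z) * cliques s ((W x ∩ W y) ∩ adj z))
    swap : L ≡ ∑ g
    swap = trans (∑-cong λ x → trans (∑-*ˡ (a x) _)
                   (∑-cong λ z → sym (*-assoc (a x) (𝟙 (W x z)) _)))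
                 (∑-swap (λ x z → b z x * cliques s (W x ∩ adj z)))
    eq : ∀ a₁ a₂ u v c → (a₁ * u) * (a₂ * v) * c ≡ (a₁ * a₂) * ((u * v) * c)
    eq = solve-∀
    step : ∀ z x y → (b z x * b z y) * cliques s ((W x ∩ adj z) ∩ (W y ∩ adj z)) ≤ h x y z
    step z x y = ≤-trans
      (≤-reflexive (trans (eq (a x) (a y) (𝟙 (W x z)) (𝟙 (W y z)) _)
        (cong (λ q → (a x * a y) * (q * cliques s ((W x ∩ adj z) ∩ (W y ∩ adj z)))) (sym (𝟙-∧ (W x z) (W y z))))))
      (*-monoʳ-≤ (a x * a y) (*-monoʳ-≤ (𝟙 (W x z ∧ W y z)) (cliques-mono s λ w p →
        let p₁ , p₂ = ∧-true (W x w ∧ adj z w) p ; p₃ , p₄ = ∧-true (W x w) p₁ ; p₅ , p₆ = ∧-true (W y w) p₂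
        in cong₂ _∧_ (cong₂ _∧_ p₃ p₅) p₄)))

-- Blow-ups from many cliques

_==_ : ∀ {n} → Fin n → Fin n → Bool
x == y = does (x F.≟ y)

==⇒≡ : ∀ {n} {x y : Fin n} → x == y ≡ true → x ≡ y
==⇒≡ {x = x} {y} p with x F.≟ y
... | yes q = q

==-refl : ∀ {n} (x : Fin n) → x == x ≡ true
==-refl x with x F.≟ x
... | yes _ = refl
... | no ¬p = contradiction refl ¬p

≢⇒==-false : ∀ {n} {x y : Fin n} → x ≢ y → x == y ≡ false
≢⇒==-false {x = x} {y} p with x F.≟ y
... | yes q = contradiction q p
... | no _  = refl

==-suc : ∀ {n} (x y : Fin n) → suc x == suc y ≡ x == y
==-suc x y with x F.≟ y
... | yes _ = refl
... | no _  = refl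

==-sym : ∀ {n} (x y : Fin n) → x == y ≡ y == x
==-sym x y = does-⇔ (mk⇔ sym sym) (x F.≟ y) (y F.≟ x)

∑-zero : ∀ n → ∑[ i < n ] 0 ≡ 0
∑-zero n = trans (∑-const n 0) (*-zeroʳ n)

∑-δ : ∀ {n} (x : Fin n) (f : Fin n → ℕ) → ∑[ y < n ] (𝟙 (y == x) * f y) ≡ f x
∑-δ {suc n} zero f = begin
  ∑[ y < suc n ] (𝟙 (y == zero) * f y) ≡⟨ ∑-suc (λ y → 𝟙 (y == zero) * f y) ⟩
  f zero + 0 + ∑[ y < n ] 0            ≡⟨ cong₂ _+_ (+-identityʳ _) (∑-zero n) ⟩
  f zero + 0                           ≡⟨ +-identityʳ _ ⟩
  f zero                               ∎
  where open ≡-Reasoning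
∑-δ {suc n} (suc x) f = begin
  ∑[ y < suc n ] (𝟙 (y == suc x) * f y)          ≡⟨ ∑-suc (λ y → 𝟙 (y == suc x) * f y) ⟩
  ∑[ y < n ] (𝟙 (suc y == suc x) * f (suc y))    ≡⟨ ∑-cong (λ y → cong (λ b → 𝟙 b * f (suc y)) (==-suc y x)) ⟩
  ∑[ y < n ] (𝟙 (y == x) * f (suc y))            ≡⟨ ∑-δ x (f ∘ suc) ⟩
  f (suc x)                                      ∎
  where open ≡-Reasoning

-- Choosing one vertex turns the density `1 / C` into `1 / 2C²`. The threshold collects the
-- condition `2C² ≤ n` of every choice; its base 1 keeps `n` nonzero.
pickDensity pickThreshold : ℕ → ℕ → ℕ
pickDensity   zero    C = C
pickDensity   (suc j) C = pickDensity j (2 * (C * C))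
pickThreshold zero    C = 1
pickThreshold (suc j) C = 2 * (C * C) ⊔ pickThreshold j (2 * (C * C))

1≤pickThreshold : ∀ j C → 1 ≤ pickThreshold j C
1≤pickThreshold zero    C = ≤-refl
1≤pickThreshold (suc j) C = ≤-trans (1≤pickThreshold j _) (m≤n⊔m _ _)

module Blowups {n : ℕ} (adj : Fin n → Fin n → Bool) where
  open Cliques adj

  module _ (s C : ℕ) (1≤n : 1 ≤ n) (W D : Subset {n})
           (dense : n ^ suc s ≤ C * ∑[ x < n ] (𝟙 (W x) * cliques s (D ∩ adj x))) where

    private
      instance
        n≢0 : NonZero n
        n≢0 = >-nonZero 1≤n
        n^s≢0 : NonZero (n ^ s)
        n^s≢0 = m^n≢0 n s
      N S : ℕ
      N = n ^ s
      S = ∑[ x < n ] (𝟙 (W x) * cliques s (D ∩ adj x))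
      T : Fin n → ℕ
      T x = ∑[ y < n ] (𝟙 (W y) * cliques s ((D ∩ adj x) ∩ (D ∩ adj y)))

      -- `T x` counts pairs of some `y` in `W` and a clique of `D` in the common neighbourhood of
      -- `x` and `y`. Cauchy-Schwarz bounds the sum of `T` over `W` below by `n ^ (2 + s) / C²`; the
      -- form is the one `∑-average` takes.
      average : n * (n * N) ≤ ∑[ x < n ] (C * C * (𝟙 (W x) * T x))
      average = *-cancelʳ-≤ (n * (n * N)) _ N (begin
        n * (n * N) * N        ≡⟨ eq₁ n N ⟩
        (n * N) * (n * N)      ≤⟨ *-mono-≤ dense dense ⟩
        (C * S) * (C * S)      ≡⟨ eq₂ C S ⟩
        (C * C) * (S * S)      ≤⟨ *-monoʳ-≤ (C * C) (cliques-cauchy-schwarz s (𝟙 ∘ W) (λ x → D ∩ adj x)) ⟩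
        (C * C) * (N * ∑[ x < n ] ∑[ y < n ] ((𝟙 (W x) * 𝟙 (W y)) * cliques s ((D ∩ adj x) ∩ (D ∩ adj y))))
          ≡⟨ cong (λ q → (C * C) * (N * q)) (∑-cong λ x → trans (∑-cong λ y → *-assoc (𝟙 (W x)) (𝟙 (W y)) _) (sym (∑-*ˡ (𝟙 (W x)) _))) ⟩
        (C * C) * (N * ∑[ x < n ] (𝟙 (W x) * T x))
          ≡⟨ eq₃ (C * C) N _ ⟩
        (C * C) * ∑[ x < n ] (𝟙 (W x) * T x) * N
          ≡⟨ cong (_* N) (∑-*ˡ (C * C) _) ⟩
        ∑[ x < n ] (C * C * (𝟙 (W x) * T x)) * N ∎)
        where
        open ≤-Reasoning
        eq₁ : ∀ n N → n * (n * N) * N ≡ (n * N) * (n * N)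
        eq₁ = solve-∀
        eq₂ : ∀ C S → (C * S) * (C * S) ≡ (C * C) * (S * S)
        eq₂ = solve-∀
        eq₃ : ∀ C N Q → C * (N * Q) ≡ C * Q * N
        eq₃ = solve-∀

    -- An `x` with `T x` at least average keeps the hypothesis alive with `D` cut down to its
    -- neighbourhood. Deleting `x` from `W`, which makes later choices distinct, loses the single
    -- term `y = x`, at most `n ^ s`; doubling `C * C` pays for it once `n` is large.
    pick-one : 2 * (C * C) ≤ n → ∃ λ x → W x ≡ true ×
      n ^ suc s ≤ 2 * (C * C) * ∑[ y < n ] (𝟙 (W y ∧ not (y == x)) * cliques s ((D ∩ adj x) ∩ adj y))
    pick-one 2CC≤n with ∑-average 1≤n _ (n * N) average
    ... | x , h with W x in Wx
    ... | false = contradiction (≤-trans h (≤-reflexive (*-zeroʳ (C * C)))) (<⇒≱ (>-nonZero⁻¹ (n ^ suc s) {{m^n≢0 n (suc s)}}))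
    ... | true  = x , Wx , +-cancelʳ-≤ (n * N) _ _ (begin
      n * N + n * N                       ≤⟨ +-mono-≤ h h ⟩
      C * C * (T x + 0) + C * C * (T x + 0) ≡⟨ eq₁ (C * C) (T x) ⟩
      2 * (C * C) * T x                   ≤⟨ *-monoʳ-≤ (2 * (C * C)) T≤ ⟩
      2 * (C * C) * (S′ + N)              ≡⟨ *-distribˡ-+ (2 * (C * C)) S′ N ⟩
      2 * (C * C) * S′ + 2 * (C * C) * N  ≤⟨ +-monoʳ-≤ (2 * (C * C) * S′) (*-monoˡ-≤ N 2CC≤n) ⟩
      2 * (C * C) * S′ + n * N            ∎)
      where
      open ≤-Reasoning
      S′ = ∑[ y < n ] (𝟙 (W y ∧ not (y == x)) * cliques s ((D ∩ adj x) ∩ adj y))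
      eq₁ : ∀ c t → c * (t + 0) + c * (t + 0) ≡ 2 * c * t
      eq₁ = solve-∀
      pointwise : ∀ y → 𝟙 (W y) * cliques s ((D ∩ adj x) ∩ (D ∩ adj y)) ≤
        𝟙 (W y ∧ not (y == x)) * cliques s ((D ∩ adj x) ∩ adj y) + 𝟙 (y == x) * N
      pointwise y with W y | y == x
      ... | false | _     = z≤n
      ... | true  | true  = ≤-trans (≤-reflexive (*-identityˡ _))
                              (≤-trans (cliques≤n^s s _) (≤-reflexive (sym (*-identityˡ _))))
      ... | true  | false = ≤-trans (*-monoʳ-≤ 1 (cliques-mono s λ z p →
              let p₁ , p₂ = ∧-true (D z ∧ adj x z) p
              in cong₂ _∧_ p₁ (proj₂ (∧-true (D z) p₂))))
            (m≤m+n _ 0)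
      T≤ : T x ≤ S′ + N
      T≤ = begin
        T x ≤⟨ ∑-mono pointwise ⟩
        ∑[ y < n ] (𝟙 (W y ∧ not (y == x)) * cliques s ((D ∩ adj x) ∩ adj y) + 𝟙 (y == x) * N) ≡⟨ ∑-+ _ _ ⟩
        S′ + ∑[ y < n ] (𝟙 (y == x) * N) ≡⟨ cong (S′ +_) (∑-δ x (λ _ → N)) ⟩
        S′ + N ∎

  -- Iterates `pick-one`: `W` holds the remaining candidates for the part, `D` the common neighbours
  -- of the vertices already chosen. After the last choice the outer sum is bounded by `n` times
  -- `cliques s D`, and a factor `n` cancels.
  pick : ∀ s j C → pickThreshold j C ≤ n → (W D : Subset) →
    n ^ suc s ≤ C * ∑[ x < n ] (𝟙 (W x) * cliques s (D ∩ adj x)) →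
    Σ (Fin j → Fin n) λ xs → (∀ i → W (xs i) ≡ true) × Injective _≡_ _≡_ xs ×
      Σ Subset λ D′ → D′ ⊆ D × (∀ i y → D′ y ≡ true → adj (xs i) y ≡ true) ×
        n ^ s ≤ pickDensity j C * cliques s D′
  pick s zero C 1≤n W D dense =
    (λ ()) , (λ ()) , (λ { {()} }) , D , (λ _ p → p) , (λ ()) , *-cancelˡ-≤ n {{>-nonZero 1≤n}} (begin
      n * n ^ s                                               ≤⟨ dense ⟩
      C * ∑[ x < n ] (𝟙 (W x) * cliques s (D ∩ adj x))        ≤⟨ *-monoʳ-≤ C (∑-mono λ x → ≤-trans
                                                                   (*-mono-≤ (𝟙≤1 (W x)) (cliques-mono s λ y p → proj₁ (∧-true (D y) p)))
                                                                   (≤-reflexive (*-identityˡ _))) ⟩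
      C * ∑[ x < n ] cliques s D                              ≡⟨ cong (C *_) (∑-const n _) ⟩
      C * (n * cliques s D)                                   ≡⟨ eq C n (cliques s D) ⟩
      n * (C * cliques s D)                                   ∎)
    where
    open ≤-Reasoning
    eq : ∀ C n q → C * (n * q) ≡ n * (C * q)
    eq = solve-∀
  pick s (suc j) C large W D dense
    with pick-one s C (≤-trans (1≤pickThreshold (suc j) C) large) W D dense (≤-trans (m≤m⊔n _ _) large)
  ... | x , Wx , dense′
    with pick s j (2 * (C * C)) (≤-trans (m≤n⊔m (2 * (C * C)) _) large) (λ y → W y ∧ not (y == x)) (D ∩ adj x) dense′
  ... | xs , W′xs , xs-inj , D′ , D′⊆ , D′adj , dense″ =
    x ∷ xs , W-all , inj , D′ , (λ y p → proj₁ (∧-true (D y) (D′⊆ y p))) , adj-all , dense″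
    where
    W-all : ∀ i → W ((x ∷ xs) i) ≡ true
    W-all zero    = Wx
    W-all (suc i) = proj₁ (∧-true (W (xs i)) (W′xs i))
    x≢xs : ∀ i → x ≢ xs i
    x≢xs i refl with () ← trans (sym (cong not (==-refl x))) (proj₂ (∧-true (W (xs i)) (W′xs i)))
    inj : Injective _≡_ _≡_ (x ∷ xs)
    inj {zero}  {zero}  _ = refl
    inj {zero}  {suc j} p = contradiction p (x≢xs j)
    inj {suc i} {zero}  p = contradiction (sym p) (x≢xs i)
    inj {suc i} {suc j} p = cong suc (xs-inj p)
    adj-all : ∀ i y → D′ y ≡ true → adj ((x ∷ xs) i) y ≡ true
    adj-all zero    y p = proj₂ (∧-true (D y) (D′⊆ y p))
    adj-all (suc i) y p = D′adj i y p

  -- Disjointness of distinct parts follows from `cross-adj` when the graph is loopless, as `nimAdj`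
  -- is.
  record Blowup (s T : ℕ) (U : Subset {n}) : Set where
    field
      part       : Fin s → Fin T → Fin n
      part⊆      : ∀ a i → U (part a i) ≡ true
      part-inj   : ∀ a → Injective _≡_ _≡_ (part a)
      cross-adj  : ∀ {a b} → a F.< b → ∀ i j → adj (part a i) (part b j) ≡ true

blowupThreshold : ℕ → ℕ → ℕ → ℕ
blowupThreshold zero    T C = 0
blowupThreshold (suc s) T C = pickThreshold T C ⊔ blowupThreshold s T (pickDensity T C)

module _ {n : ℕ} (adj : Fin n → Fin n → Bool) where
  open Cliques adj
  open Blowups adj

  -- Peels off one part at a time: `pick` with `W` and `D` both equal to `U` yields the first part,
  -- and the other parts are found among its common neighbours, which are still dense in smaller
  -- cliques.
  dense⇒Blowup : ∀ s T C → blowupThreshold s T C ≤ n → (U : Subset) →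
    n ^ s ≤ C * cliques s U → Blowup s T U
  dense⇒Blowup zero T C _ U _ = record
    { part = λ () ; part⊆ = λ () ; part-inj = λ () ; cross-adj = λ { {()} } }
  dense⇒Blowup (suc s) T C large U dense
    with pick s T C (≤-trans (m≤m⊔n _ _) large) U U dense
  ... | xs , Uxs , xs-inj , D , D⊆U , D-adj , dense′
    with dense⇒Blowup s T (pickDensity T C) (≤-trans (m≤n⊔m (pickThreshold T C) _) large) D dense′
  ... | B = record
    { part      = xs ∷ part
    ; part⊆     = λ { zero → Uxs ; (suc a) i → D⊆U _ (part⊆ a i) }
    ; part-inj  = λ { zero → xs-inj ; (suc a) → part-inj a }
    ; cross-adj = λ { {zero} {suc b} _ i j → D-adj i _ (part⊆ b j)
                    ; {suc a} {suc b} (s≤s a<b) → cross-adj a<b } }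
    where open Blowup B

-- Near-optimal partitions from few cliques

does⇒ : ∀ {A : Set} (d : Dec A) → does d ≡ true → A
does⇒ (yes a) _ = a

¬does⇒ : ∀ {A : Set} (d : Dec A) → does d ≡ false → ¬ A
¬does⇒ (no ¬a) _ = ¬a

argmax : ∀ {n} (f : Fin n → ℕ) (P : Fin n → Bool) →
  (∀ x → P x ≡ false) ⊎ (∃ λ x → P x ≡ true × ∀ y → P y ≡ true → f y ≤ f x)
argmax {zero} f P = inj₁ λ ()
argmax {suc n} f P with P zero in P₀ | argmax (f ∘ suc) (P ∘ suc)
... | false | inj₁ none = inj₁ λ { zero → P₀ ; (suc x) → none x }
... | true  | inj₁ none = inj₂ (zero , P₀ , λ
        { zero _ → ≤-refl ; (suc y) p → contradiction (trans (sym p) (none y)) λ () })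
... | false | inj₂ (x , Px , max) = inj₂ (suc x , Px , λ
        { zero p → contradiction (trans (sym p) P₀) λ () ; (suc y) p → max y p })
... | true  | inj₂ (x , Px , max) with ≤-total (f zero) (f (suc x))
...   | inj₁ f₀≤ = inj₂ (suc x , Px , λ { zero _ → f₀≤ ; (suc y) p → max y p })
...   | inj₂ ≤f₀ = inj₂ (zero , P₀ , λ { zero _ → ≤-refl ; (suc y) p → ≤-trans (max y p) ≤f₀ })

∑∑-+³ : ∀ {m n} (f g h : Fin m → Fin n → ℕ) →
  ∑[ x < m ] ∑[ y < n ] (f x y + g x y + h x y) ≡
  ∑[ x < m ] ∑[ y < n ] f x y + ∑[ x < m ] ∑[ y < n ] g x y + ∑[ x < m ] ∑[ y < n ] h x y
∑∑-+³ {m} {n} f g h = begin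
  ∑[ x < m ] ∑[ y < n ] (f x y + g x y + h x y)
    ≡⟨ ∑-cong (λ x → trans (∑-+ (λ y → f x y + g x y) (h x)) (cong (_+ ∑ (h x)) (∑-+ (f x) (g x)))) ⟩
  ∑[ x < m ] (∑ (f x) + ∑ (g x) + ∑ (h x))
    ≡⟨ trans (∑-+ (λ x → ∑ (f x) + ∑ (g x)) (λ x → ∑ (h x))) (cong (_+ ∑[ x < m ] ∑ (h x)) (∑-+ (λ x → ∑ (f x)) (λ x → ∑ (g x)))) ⟩
  ∑[ x < m ] ∑ (f x) + ∑[ x < m ] ∑ (g x) + ∑[ x < m ] ∑ (h x) ∎
  where open ≡-Reasoning

∑-product : ∀ {m n} (f : Fin m → ℕ) (g : Fin n → ℕ) → ∑[ x < m ] ∑[ y < n ] (f x * g y) ≡ ∑ f * ∑ g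
∑-product f g = trans (∑-cong λ x → sym (∑-*ˡ (f x) g)) (sym (∑-*ʳ (∑ g) f))

-- The base is `2 * K` because with a single class every edge has weight 2. In the recursion the
-- error `n²` is shared: half is left to the recursive call, hence `2 * K`, and half to the bad
-- vertices, hence the factor `4 * K`. The `suc` makes the badness constant nonzero, so that it can
-- be cancelled.
partitionDensity : ℕ → ℕ → ℕ
partitionDensity zero    K = 2 * K
partitionDensity (suc r) K = 4 * K * suc (partitionDensity r (2 * K))

module Partition {n : ℕ} (1≤n : 1 ≤ n) (adj : Fin n → Fin n → Bool) (adj-sym : ∀ x y → adj x y ≡ adj y x) where
  open Cliques adj

  private
    instance
      n≢0 : NonZero n
      n≢0 = >-nonZero 1≤n

  card : Subset {n} → ℕ
  card U = ∑[ x < n ] 𝟙 (U x)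

  -- 2 (e(G[U]) + Σ e(Aᵢ)), the left-hand side of Füredi's inequality.
  weight : ∀ {r} → Subset → (Fin n → Fin r) → ℕ
  weight U c = ∑[ x < n ] ∑[ y < n ] ((𝟙 (U x) * 𝟙 (U y)) * (𝟙 (adj x y) * (1 + 𝟙 (c x == c y))))

  cross : ∀ {r} → Subset → (Fin n → Fin r) → ℕ
  cross U c = ∑[ x < n ] ∑[ y < n ] ((𝟙 (U x) * 𝟙 (U y)) * 𝟙 (not (c x == c y)))

  split : ∀ {r} → Subset → (Fin n → Fin r) → Fin n → Fin (suc r)
  split p c x = if p x then suc (c x) else zero

  deg : Subset → Fin n → ℕ
  deg U x = card (U ∩ adj x)

  weight-pointwise : ∀ {r} ux uy px py A (i j : Fin r) →
    (𝟙 ux * 𝟙 uy) * (A * (1 + 𝟙 ((if px then suc i else zero) == (if py then suc j else zero)))) ≡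
    𝟙 (ux ∧ not px) * (𝟙 uy * A) + 𝟙 (uy ∧ not py) * (𝟙 ux * A)
      + (𝟙 (ux ∧ px) * 𝟙 (uy ∧ py)) * (A * (1 + 𝟙 (i == j)))
  weight-pointwise false false px    py    A i j = refl
  weight-pointwise false true  px    true  A i j = refl
  weight-pointwise false true  px    false A i j = refl
  weight-pointwise true  false true  py    A i j = refl
  weight-pointwise true  false false py    A i j = refl
  weight-pointwise true  true  true  true  A i j = cong (λ b → 1 * (A * (1 + 𝟙 b))) (==-suc i j)
  weight-pointwise true  true  true  false A i j = eq A
    where eq : ∀ A → 1 * (A * 1) ≡ 0 * (1 * A) + 1 * (1 * A) + 0
          eq = solve-∀
  weight-pointwise true  true  false true  A i j = eq A
    where eq : ∀ A → 1 * (A * 1) ≡ 1 * (1 * A) + 0 * (1 * A) + 0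
          eq = solve-∀
  weight-pointwise true  true  false false A i j = eq A
    where eq : ∀ A → 1 * (A * 2) ≡ 1 * (1 * A) + 1 * (1 * A) + 0
          eq = solve-∀

  cross-pointwise : ∀ {r} ux uy px py (i j : Fin r) →
    (𝟙 ux * 𝟙 uy) * 𝟙 (not ((if px then suc i else zero) == (if py then suc j else zero))) ≡
    𝟙 (ux ∧ not px) * 𝟙 (uy ∧ py) + 𝟙 (ux ∧ px) * 𝟙 (uy ∧ not py)
      + (𝟙 (ux ∧ px) * 𝟙 (uy ∧ py)) * 𝟙 (not (i == j))
  cross-pointwise false uy    px    py    i j = refl
  cross-pointwise true  false true  py    i j = refl
  cross-pointwise true  false false py    i j = refl
  cross-pointwise true  true  true  true  i j = cong (λ b → 1 * 𝟙 (not b)) (==-suc i j)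
  cross-pointwise true  true  true  false i j = refl
  cross-pointwise true  true  false true  i j = refl
  cross-pointwise true  true  false false i j = refl

  -- Summing degrees over the new class counts an edge leaving it once and an edge inside it twice,
  -- which is how `weight` counts them; the factor 2 comes from ordered pairs.
  weight-split : ∀ {r} U p (c : Fin n → Fin r) →
    weight U (split p c) ≡ 2 * ∑[ x < n ] (𝟙 (U x ∧ not (p x)) * deg U x) + weight (U ∩ p) c
  weight-split U p c = begin
    weight U (split p c)
      ≡⟨ ∑-cong (λ x → ∑-cong λ y → weight-pointwise (U x) (U y) (p x) (p y) (𝟙 (adj x y)) (c x) (c y)) ⟩
    ∑[ x < n ] ∑[ y < n ] (e x y + e′ x y + w x y)
      ≡⟨ ∑∑-+³ e e′ w ⟩
    E + E′ + weight (U ∩ p) c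
      ≡⟨ cong (λ q → E + q + weight (U ∩ p) c) (trans (∑-swap e′) (∑-cong λ y → ∑-cong λ x →
           cong (λ b → 𝟙 (U y ∧ not (p y)) * (𝟙 (U x) * 𝟙 b)) (adj-sym x y))) ⟩
    E + E + weight (U ∩ p) c
      ≡⟨ cong (_+ weight (U ∩ p) c) (cong (E +_) (sym (+-identityʳ E))) ⟩
    2 * E + weight (U ∩ p) c
      ≡⟨ cong (λ q → 2 * q + weight (U ∩ p) c) (∑-cong λ x → trans (sym (∑-*ˡ (𝟙 (U x ∧ not (p x))) _))
           (cong (𝟙 (U x ∧ not (p x)) *_) (∑-cong λ y → sym (𝟙-∧ (U y) (adj x y))))) ⟩
    2 * ∑[ x < n ] (𝟙 (U x ∧ not (p x)) * deg U x) + weight (U ∩ p) c ∎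
    where
    open ≡-Reasoning
    e e′ w : Fin n → Fin n → ℕ
    e  x y = 𝟙 (U x ∧ not (p x)) * (𝟙 (U y) * 𝟙 (adj x y))
    e′ x y = 𝟙 (U y ∧ not (p y)) * (𝟙 (U x) * 𝟙 (adj x y))
    w  x y = (𝟙 (U x ∧ p x) * 𝟙 (U y ∧ p y)) * (𝟙 (adj x y) * (1 + 𝟙 (c x == c y)))
    E  = ∑[ x < n ] ∑[ y < n ] e x y
    E′ = ∑[ x < n ] ∑[ y < n ] e′ x y

  cross-split : ∀ {r} U p (c : Fin n → Fin r) →
    cross U (split p c) ≡ 2 * (card (U ∩ (not ∘ p)) * card (U ∩ p)) + cross (U ∩ p) c
  cross-split U p c = begin
    cross U (split p c)
      ≡⟨ ∑-cong (λ x → ∑-cong λ y → cross-pointwise (U x) (U y) (p x) (p y) (c x) (c y)) ⟩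
    ∑[ x < n ] ∑[ y < n ] (a x * v y + v x * a y + w x y)
      ≡⟨ ∑∑-+³ (λ x y → a x * v y) (λ x y → v x * a y) w ⟩
    ∑[ x < n ] ∑[ y < n ] (a x * v y) + ∑[ x < n ] ∑[ y < n ] (v x * a y) + cross (U ∩ p) c
      ≡⟨ cong (_+ cross (U ∩ p) c) (cong₂ _+_ (∑-product a v) (∑-product v a)) ⟩
    ∑ a * ∑ v + ∑ v * ∑ a + cross (U ∩ p) c
      ≡⟨ eq (∑ a) (∑ v) _ ⟩
    2 * (∑ a * ∑ v) + cross (U ∩ p) c ∎
    where
    open ≡-Reasoning
    a v : Fin n → ℕ
    a x = 𝟙 (U x ∧ not (p x))
    v x = 𝟙 (U x ∧ p x)
    w : Fin n → Fin n → ℕ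
    w x y = (v x * v y) * 𝟙 (not (c x == c y))
    eq : ∀ a v w → a * v + v * a + w ≡ 2 * (a * v) + w
    eq = solve-∀

  cliques-∅ : ∀ s {U : Subset} → (∀ x → U x ≡ false) → cliques (suc s) U ≡ 0
  cliques-∅ s {U} ∅ = trans (∑-cong λ x → cong (λ b → 𝟙 b * cliques s (U ∩ adj x)) (∅ x)) (∑-zero n)

  card≤n : ∀ U → card U ≤ n
  card≤n U = ≤-trans (∑-mono (𝟙≤1 ∘ U)) (≤-reflexive (trans (∑-const n 1) (*-identityʳ n)))

  module _ (s C : ℕ) (U : Subset {n}) where

    bad : Subset
    bad x = does (n ^ s <? C * cliques s (U ∩ adj x))

    bad⇒ : ∀ x → bad x ≡ true → n ^ s ≤ C * cliques s (U ∩ adj x)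
    bad⇒ x p = <⇒≤ (does⇒ (n ^ s <? C * cliques s (U ∩ adj x)) p)

    ¬bad⇒ : ∀ x → bad x ≡ false → C * cliques s (U ∩ adj x) ≤ n ^ s
    ¬bad⇒ x p = ≮⇒≥ (¬does⇒ (n ^ s <? C * cliques s (U ∩ adj x)) p)

    -- Markov's inequality: each bad vertex starts more than `n ^ s / C` ordered cliques.
    bad-count : n ^ s * card (U ∩ bad) ≤ C * cliques (suc s) U
    bad-count = begin
      n ^ s * card (U ∩ bad)                                   ≡⟨ ∑-*ˡ (n ^ s) _ ⟩
      ∑[ x < n ] (n ^ s * 𝟙 (U x ∧ bad x))                     ≤⟨ ∑-mono pointwise ⟩
      ∑[ x < n ] (C * (𝟙 (U x) * cliques s (U ∩ adj x)))       ≡⟨ ∑-*ˡ C _ ⟨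
      C * cliques (suc s) U                                    ∎
      where
      open ≤-Reasoning
      pointwise : ∀ x → n ^ s * 𝟙 (U x ∧ bad x) ≤ C * (𝟙 (U x) * cliques s (U ∩ adj x))
      pointwise x with U x
      ... | false = ≤-trans (≤-reflexive (*-zeroʳ (n ^ s))) z≤n
      ... | true with bad x in b
      ...   | false = ≤-trans (≤-reflexive (*-zeroʳ (n ^ s))) z≤n
      ...   | true  = ≤-trans (≤-reflexive (*-identityʳ _))
                        (≤-trans (bad⇒ x b) (*-monoʳ-≤ C (m≤m+n _ 0)))

  -- The set is the neighbourhood of a vertex of largest degree among those that are not bad, so it
  -- inherits a small clique count. Bad vertices may have larger degree and are charged `n`. If all
  -- vertices of `U` are bad, the empty set serves.
  neighbourhood : ∀ s C U → Σ Subset λ p → C * cliques (suc s) (U ∩ p) ≤ n ^ suc s ×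
    (∀ x → U x ≡ true → deg U x ≤ card (U ∩ p) + n * 𝟙 (bad (suc s) C U x))
  neighbourhood s C U with argmax (deg U) (U ∩ (not ∘ bad (suc s) C U))
  ... | inj₁ none = (λ _ → false) ,
        ≤-trans (≤-reflexive (trans (cong (C *_) (cliques-∅ s {U ∩ (λ _ → false)} λ x → ∧-falseʳ (U x))) (*-zeroʳ C))) z≤n ,
        bound
    where
    ∧-falseʳ : ∀ b → b ∧ false ≡ false
    ∧-falseʳ false = refl
    ∧-falseʳ true  = refl
    bound : ∀ x → U x ≡ true → deg U x ≤ card (U ∩ (λ _ → false)) + n * 𝟙 (bad (suc s) C U x)
    bound x Ux with bad (suc s) C U x | none x
    ... | true  | _ = ≤-trans (card≤n _) (≤-trans (≤-reflexive (sym (*-identityʳ n))) (m≤n+m _ _))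
    ... | false | p with () ← trans (sym (cong (_∧ true) Ux)) p
  ... | inj₂ (x₁ , Px₁ , max) = adj x₁ , small , bound
    where
    good : bad (suc s) C U x₁ ≡ false
    good with bad (suc s) C U x₁ | proj₂ (∧-true (U x₁) Px₁)
    ... | false | _ = refl
    small : C * cliques (suc s) (U ∩ adj x₁) ≤ n ^ suc s
    small = ¬bad⇒ (suc s) C U x₁ good
    bound : ∀ x → U x ≡ true → deg U x ≤ card (U ∩ adj x₁) + n * 𝟙 (bad (suc s) C U x)
    bound x Ux with bad (suc s) C U x in b
    ... | true  = ≤-trans (card≤n _) (≤-trans (≤-reflexive (sym (*-identityʳ n))) (m≤n+m _ _))
    ... | false = ≤-trans (max x (cong₂ _∧_ Ux (cong not b))) (m≤m+n _ _)

  -- Füredi's induction: the vertices of `U` outside the chosen neighbourhood form a new class, and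
  -- the neighbourhood is partitioned recursively. The degree bound turns the degree sum over the
  -- new class into its number of cross pairs, up to the bad vertices.
  few-cliques⇒partition : ∀ r K U → partitionDensity r K * cliques (2 + r) U ≤ n ^ (2 + r) →
    Σ (Fin n → Fin (suc r)) λ c → K * weight U c ≤ K * cross U c + n * n
  few-cliques⇒partition zero K U few = c₀ , (begin
    K * weight U c₀     ≡⟨ cong (K *_) (trans (∑-cong λ x → trans (∑-cong λ y → pointwise (U x) (U y) (adj x y))
                                       (trans (sym (∑-*ˡ 2 _)) (cong (2 *_) (sym (∑-*ˡ (𝟙 (U x)) _))))) (sym (∑-*ˡ 2 _))) ⟩
    K * (2 * cliques 2 U)         ≡⟨ eq K (cliques 2 U) ⟩
    (2 * K) * cliques 2 U         ≤⟨ few ⟩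
    n ^ 2                         ≡⟨ cong (n *_) (*-identityʳ n) ⟩
    n * n                         ≤⟨ m≤n+m _ _ ⟩
    K * cross U c₀ + n * n ∎)
    where
    open ≤-Reasoning
    c₀ : Fin n → Fin 1
    c₀ _ = zero
    eq : ∀ K q → K * (2 * q) ≡ (2 * K) * q
    eq = solve-∀
    pointwise : ∀ a b e → (𝟙 a * 𝟙 b) * (𝟙 e * 2) ≡ 2 * (𝟙 a * (𝟙 (b ∧ e) * 1))
    pointwise false b     e     = refl
    pointwise true  false e     = refl
    pointwise true  true  false = refl
    pointwise true  true  true  = refl
  few-cliques⇒partition (suc r) K U few
    with neighbourhood (suc r) (suc (partitionDensity r (2 * K))) U
  ... | p , small , bound
    with few-cliques⇒partition r (2 * K) (U ∩ p) (≤-trans (*-monoˡ-≤ (cliques (2 + r) (U ∩ p)) (n≤1+n (partitionDensity r (2 * K)))) small)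
  ... | c , ih = split p c , *-cancelˡ-≤ 2 (begin
    2 * (K * weight U (split p c))
      ≡⟨ trans (sym (*-assoc 2 K _)) (cong (2 * K *_) (weight-split U p c)) ⟩
    2 * K * (2 * ∑[ x < n ] (𝟙 (U x ∧ not (p x)) * deg U x) + weight (U ∩ p) c)
      ≡⟨ *-distribˡ-+ (2 * K) _ _ ⟩
    2 * K * (2 * ∑[ x < n ] (𝟙 (U x ∧ not (p x)) * deg U x)) + 2 * K * weight (U ∩ p) c
      ≤⟨ +-mono-≤ (*-monoʳ-≤ (2 * K) (*-monoʳ-≤ 2 degree-sum)) ih ⟩
    2 * K * (2 * (a * v + n * B)) + (2 * K * cross (U ∩ p) c + n * n)
      ≡⟨ eq₁ K (a * v) n B (cross (U ∩ p) c) ⟩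
    2 * (K * (2 * (a * v) + cross (U ∩ p) c)) + (n * (4 * K * B) + n * n)
      ≤⟨ +-monoʳ-≤ (2 * (K * (2 * (a * v) + cross (U ∩ p) c))) (+-monoˡ-≤ (n * n) (*-monoʳ-≤ n few-bad)) ⟩
    2 * (K * (2 * (a * v) + cross (U ∩ p) c)) + (n * n + n * n)
      ≡⟨ eq₂ (K * (2 * (a * v) + cross (U ∩ p) c)) (n * n) ⟩
    2 * (K * (2 * (a * v) + cross (U ∩ p) c) + n * n)
      ≡⟨ cong (λ q → 2 * (K * q + n * n)) (cross-split U p c) ⟨
    2 * (K * cross U (split p c) + n * n) ∎)
    where
    open ≤-Reasoning
    C = suc (partitionDensity r (2 * K))
    a = card (U ∩ (not ∘ p))
    v = card (U ∩ p)
    B = card (U ∩ bad (2 + r) C U)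
    eq₁ : ∀ K av n B w → 2 * K * (2 * (av + n * B)) + (2 * K * w + n * n) ≡ 2 * (K * (2 * av + w)) + (n * (4 * K * B) + n * n)
    eq₁ = solve-∀
    eq₂ : ∀ x y → 2 * x + (y + y) ≡ 2 * (x + y)
    eq₂ = solve-∀
    few-bad : 4 * K * B ≤ n
    few-bad = *-cancelˡ-≤ (C * n ^ (2 + r)) {{m*n≢0 C (n ^ (2 + r)) {{_}} {{m^n≢0 n (2 + r)}}}} (begin
      C * n ^ (2 + r) * (4 * K * B)                  ≡⟨ eq₃ C (n ^ (2 + r)) K B ⟩
      4 * K * C * (n ^ (2 + r) * B)                  ≤⟨ *-monoʳ-≤ (4 * K * C) (bad-count (2 + r) C U) ⟩
      4 * K * C * (C * cliques (3 + r) U)            ≡⟨ eq₄ (4 * K * C) C _ ⟩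
      C * (4 * K * C * cliques (3 + r) U)            ≤⟨ *-monoʳ-≤ C few ⟩
      C * n ^ (3 + r)                                ≡⟨ eq₅ C n (n ^ (2 + r)) ⟩
      C * n ^ (2 + r) * n                            ∎)
      where
      eq₃ : ∀ C N K B → C * N * (4 * K * B) ≡ 4 * K * C * (N * B)
      eq₃ = solve-∀
      eq₄ : ∀ d C q → d * (C * q) ≡ C * (d * q)
      eq₄ = solve-∀
      eq₅ : ∀ C n N → C * (n * N) ≡ C * N * n
      eq₅ = solve-∀
    degree-sum : ∑[ x < n ] (𝟙 (U x ∧ not (p x)) * deg U x) ≤ a * v + n * B
    degree-sum = begin
      ∑[ x < n ] (𝟙 (U x ∧ not (p x)) * deg U x)                                              ≤⟨ ∑-mono pointwise ⟩
      ∑[ x < n ] (𝟙 (U x ∧ not (p x)) * v + n * 𝟙 (U x ∧ bad (2 + r) C U x))                  ≡⟨ ∑-+ _ _ ⟩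
      ∑[ x < n ] (𝟙 (U x ∧ not (p x)) * v) + ∑[ x < n ] (n * 𝟙 (U x ∧ bad (2 + r) C U x))     ≡⟨ cong₂ _+_ (∑-*ʳ v _) (∑-*ˡ n _) ⟨
      a * v + n * B                                                                           ∎
      where
      pointwise : ∀ x → 𝟙 (U x ∧ not (p x)) * deg U x ≤ 𝟙 (U x ∧ not (p x)) * v + n * 𝟙 (U x ∧ bad (2 + r) C U x)
      pointwise x with U x | bound x
      ... | false | _ = z≤n
      ... | true  | f with p x
      ...   | true  = z≤n
      ...   | false = ≤-trans (≤-reflexive (+-identityʳ _)) (≤-trans (f refl)
                        (≤-reflexive (cong (_+ n * 𝟙 (bad (2 + r) C U x)) (sym (+-identityʳ v)))))

-- Ramsey reduction to feasible colourings

StrictMono : ∀ {m n} → (Fin m → Fin n) → Set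
StrictMono p = ∀ {i j} → i F.< j → p i F.< p j

∷-StrictMono : ∀ {m n} {p : Fin m → Fin n} → StrictMono p → StrictMono (zero ∷ (suc ∘ p))
∷-StrictMono mono {zero}  {suc j} _         = s≤s z≤n
∷-StrictMono mono {suc i} {suc j} (s≤s i<j) = s≤s (mono i<j)

StrictMono⇒Injective : ∀ {m n} {p : Fin m → Fin n} → StrictMono p → Injective _≡_ _≡_ p
StrictMono⇒Injective mono {i} {j} eq with F.<-cmp i j
... | tri< i<j _ _ = contradiction eq (F.<⇒≢ (mono i<j))
... | tri≈ _ i≡j _ = i≡j
... | tri> _ _ j<i = contradiction (sym eq) (F.<⇒≢ (mono j<i))

enumerate : ∀ {n} M (P : Fin n → Bool) → M ≤ ∑ (𝟙 ∘ P) →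
  Σ (Fin M → Fin n) λ q → StrictMono q × (∀ j → P (q j) ≡ true)
enumerate zero P _ = (λ ()) , (λ { {()} }) , λ ()
enumerate {zero} (suc M) P le = contradiction (≤-trans le (≤-reflexive (∑-empty _))) λ ()
enumerate {suc n} (suc M) P le with P zero in P₀ | subst (suc M ≤_) (∑-suc (𝟙 ∘ P)) le
... | true | le′ with enumerate M (P ∘ suc) (s≤s⁻¹ le′)
...   | q , mono , all = zero ∷ (suc ∘ q) , ∷-StrictMono mono , λ { zero → P₀ ; (suc j) → all j }
enumerate {suc n} (suc M) P le | false | le′
  with enumerate (suc M) (P ∘ suc) le′
...   | q , mono , all = suc ∘ q , (λ i<j → s≤s (mono i<j)) , all

∑-fibres : ∀ {n K} (f : Fin n → Fin K) → ∑[ c < K ] ∑[ x < n ] 𝟙 (f x == c) ≡ n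
∑-fibres {n} {K} f = begin
  ∑[ c < K ] ∑[ x < n ] 𝟙 (f x == c)         ≡⟨ ∑-swap (λ c x → 𝟙 (f x == c)) ⟩
  ∑[ x < n ] ∑[ c < K ] 𝟙 (f x == c)         ≡⟨ ∑-cong (λ x → trans (∑-cong (λ c → trans (cong 𝟙 (==-sym (f x) c)) (sym (*-identityʳ _)))) (∑-δ (f x) (λ _ → 1))) ⟩
  ∑[ x < n ] 1                               ≡⟨ trans (∑-const n 1) (*-identityʳ n) ⟩
  n                                          ∎
  where
  open ≡-Reasoning

pigeonhole : ∀ {n K} M → 1 ≤ K → (f : Fin n → Fin K) → K * M ≤ n →
  ∃ λ c → Σ (Fin M → Fin n) λ q → StrictMono q × (∀ j → f (q j) ≡ c)
pigeonhole {n} {K} M 1≤K f large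
  with ∑-average 1≤K (λ c → ∑[ x < n ] 𝟙 (f x == c)) M (≤-trans large (≤-reflexive (sym (∑-fibres f))))
... | c , le with enumerate M (λ x → f x == c) le
...   | q , mono , all = c , q , mono , λ j → ==⇒≡ (all j)

endHomogeneousBound : ℕ → ℕ → ℕ
endHomogeneousBound K zero    = 0
endHomogeneousBound K (suc L) = suc (K * endHomogeneousBound K L)

-- The usual first half of Ramsey's theorem: restrict repeatedly to a majority colour class at the
-- first vertex, so that the colour of a pair depends only on its smaller index. One more
-- `pigeonhole` on these colours then gives `ramsey`.
end-homogeneous : ∀ {n K} L → 1 ≤ K → endHomogeneousBound K L ≤ n → (χ : Fin n → Fin n → Fin K) →
  Σ (Fin L → Fin n) λ p → StrictMono p ×
  Σ (Fin L → Fin K) λ c → ∀ {i j} → i F.< j → χ (p i) (p j) ≡ c i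
end-homogeneous zero 1≤K _ χ = (λ ()) , (λ { {()} }) , (λ ()) , λ { {()} }
end-homogeneous {suc n} {K} (suc L) 1≤K (s≤s large) χ
  with pigeonhole (endHomogeneousBound K L) 1≤K (λ j → χ zero (suc j)) large
... | c₀ , q , q-mono , q-col
  with end-homogeneous L 1≤K ≤-refl (λ i j → χ (suc (q i)) (suc (q j)))
... | p , p-mono , c , p-col =
  zero ∷ (suc ∘ q ∘ p) , ∷-StrictMono (q-mono ∘ p-mono) , c₀ ∷ c , col
  where
  col : ∀ {i j} → i F.< j → χ ((zero ∷ (suc ∘ q ∘ p)) i) ((zero ∷ (suc ∘ q ∘ p)) j) ≡ (c₀ ∷ c) i
  col {zero}  {suc j} _         = q-col (p j)
  col {suc i} {suc j} (s≤s i<j) = p-col i<j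

ramsey : ∀ {n K} M → 1 ≤ K → endHomogeneousBound K (K * M) ≤ n → (χ : Fin n → Fin n → Fin K) →
  Σ (Fin M → Fin n) λ p → StrictMono p × ∃ λ c → ∀ {i j} → i F.< j → χ (p i) (p j) ≡ c
ramsey {K = K} M 1≤K large χ with end-homogeneous (K * M) 1≤K large χ
... | p , p-mono , col , p-col with pigeonhole M 1≤K col ≤-refl
...   | c , q , q-mono , q-col =
  p ∘ q , p-mono ∘ q-mono , c , λ {i} i<j → trans (p-col (q-mono i<j)) (q-col i)

combine-monoʳ-< : ∀ {m n} (a : Fin m) {i j : Fin n} → i F.< j → combine a i F.< combine a j
combine-monoʳ-< {n = n} a {i} {j} i<j = subst₂ _<_ (sym (F.toℕ-combine a i)) (sym (F.toℕ-combine a j))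
  (+-monoʳ-< (n * F.toℕ a) i<j)

-- The number of `s` by `s` matrices over `k` colours, in the shape produced by applying `funToFin`
-- twice.
matrixColours : ℕ → ℕ → ℕ
matrixColours k s = (k ^ s) ^ s

blowupSize : ℕ → ℕ → ℕ → ℕ
blowupSize k s m = endHomogeneousBound (matrixColours k s) (matrixColours k s * (s * m))

record Homogeneous {k n} (φ : Fin n → Fin n → Fin k) (adj : Fin n → Fin n → Bool) (s m : ℕ) : Set where
  field
    vertex       : Fin s → Fin m → Fin n
    vertex-inj   : ∀ a → Injective _≡_ _≡_ (vertex a)
    cross-adj    : ∀ {a b} → a ≢ b → ∀ i j → adj (vertex a i) (vertex b j) ≡ true
    cross-colour : ∀ {a b} → a ≢ b → ∀ i j i′ j′ →
                   φ (vertex a i) (vertex b j) ≡ φ (vertex a i′) (vertex b j′)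
    part-colour  : ∀ a {i j i′ j′} → i ≢ j → i′ ≢ j′ →
                   φ (vertex a i) (vertex a j) ≡ φ (vertex a i′) (vertex a j′)

-- One application of Ramsey's theorem suffices: colour p < q by the matrix φ (Aₐ p) (A_b q), and give
-- the parts disjoint blocks of the homogeneous index set.
Blowup⇒Homogeneous : ∀ {k n} (φ : Fin n → Fin n → Fin k) → (∀ u w → φ u w ≡ φ w u) →
  (adj : Fin n → Fin n → Bool) → (∀ u w → adj u w ≡ adj w u) → 1 ≤ k →
  ∀ s m {U} → Blowups.Blowup adj s (blowupSize k s m) U → Homogeneous φ adj s m
Blowup⇒Homogeneous {k} {n} φ φ-sym adj adj-sym 1≤k s m B
  with ramsey (s * m) 1≤K ≤-refl (λ p q → funToFin (λ a → funToFin (λ b → φ (part a p) (part b q))))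
  where
  open Blowups.Blowup B
  1≤K : 1 ≤ matrixColours k s
  1≤K = >-nonZero⁻¹ _ {{m^n≢0 (k ^ s) s {{m^n≢0 k s {{>-nonZero 1≤k}}}}}}
... | p , p-mono , c , p-col = record
  { vertex       = vertex
  ; vertex-inj   = λ a {i} {j} eq → F.combine-injectiveʳ a i a j (StrictMono⇒Injective p-mono (part-inj a eq))
  ; cross-adj    = adjacent
  ; cross-colour = cross
  ; part-colour  = λ a i≢j i′≢j′ → trans (within a i≢j) (sym (within a i′≢j′))
  }
  where
  open Blowups.Blowup B renaming (cross-adj to part-adj)
  vertex : Fin s → Fin m → Fin n
  vertex a i = part a (p (combine a i))
  ξ : Fin s → Fin s → Fin k
  ξ a b = finToFun {k} {s} (finToFun {k ^ s} {s} c a) b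
  -- Homogeneity fixes the matrix only for increasing index pairs; the reverse order is reached
  -- through `φ-sym`.
  colour : ∀ a b {i j} → i F.< j → φ (part a (p i)) (part b (p j)) ≡ ξ a b
  colour a b {i} {j} i<j = begin
    φ (part a (p i)) (part b (p j))                        ≡⟨ F.finToFun-funToFin (row a) b ⟨
    finToFun (funToFin (row a)) b                          ≡⟨ cong (λ z → finToFun z b) (F.finToFun-funToFin (funToFin ∘ row) a) ⟨
    finToFun (finToFun (funToFin (funToFin ∘ row)) a) b    ≡⟨ cong (λ z → finToFun {k} {s} (finToFun {k ^ s} {s} z a) b) (p-col i<j) ⟩
    ξ a b                                                  ∎
    where
    open ≡-Reasoning
    row : Fin s → Fin s → Fin k
    row a b = φ (part a (p i)) (part b (p j))
  adjacent : ∀ {a b} → a ≢ b → ∀ i j → adj (vertex a i) (vertex b j) ≡ true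
  adjacent {a} {b} a≢b i j with F.<-cmp a b
  ... | tri< a<b _ _ = part-adj a<b _ _
  ... | tri≈ _ a≡b _ = contradiction a≡b a≢b
  ... | tri> _ _ b<a = trans (adj-sym _ _) (part-adj b<a _ _)
  cross : ∀ {a b} → a ≢ b → ∀ i j i′ j′ → φ (vertex a i) (vertex b j) ≡ φ (vertex a i′) (vertex b j′)
  cross {a} {b} a≢b i j i′ j′ with F.<-cmp a b
  -- Blocks are ordered like their parts, so every index in block `a` precedes every index in block
  -- `b` and only the entry `ξ a b` is read.
  ... | tri< a<b _ _ = trans (colour a b (F.combine-monoˡ-< i j a<b)) (sym (colour a b (F.combine-monoˡ-< i′ j′ a<b)))
  ... | tri≈ _ a≡b _ = contradiction a≡b a≢b
  ... | tri> _ _ b<a = trans (trans (φ-sym _ _) (colour b a (F.combine-monoˡ-< j i b<a)))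
                         (sym (trans (φ-sym _ _) (colour b a (F.combine-monoˡ-< j′ i′ b<a))))
  within : ∀ a {i j} → i ≢ j → φ (vertex a i) (vertex a j) ≡ ξ a a
  within a {i} {j} i≢j with F.<-cmp i j
  ... | tri< i<j _ _ = colour a a (combine-monoʳ-< a i<j)
  ... | tri≈ _ i≡j _ = contradiction i≡j i≢j
  ... | tri> _ _ j<i = trans (φ-sym _ _) (colour a a (combine-monoʳ-< a j<i))

NonBipartite⇒edge : ∀ H → NonBipartite H → ∃₂ λ a b → adj H a b ≡ true
NonBipartite⇒edge H nonBip with F.any? (λ a → F.any? λ b → adj H a b Bool.≟ true)
... | yes edge  = edge
... | no ¬edge  = contradiction ((λ _ → true) , λ a b e → contradiction (a , b , e) ¬edge) nonBip

-- The diagonal is removed by hand: no copy sends an edge to a loop, so `IsNIM Hs φ u u` holds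
-- vacuously.
nimAdj : ∀ {k n} → (Fin k → Graph) → (Fin n → Fin n → Fin k) → Fin n → Fin n → Bool
nimAdj Hs φ u w = not (u == w) ∧ does (isNIM? Hs φ u w)

module _ {k n : ℕ} (Hs : Fin k → Graph) (φ : Fin n → Fin n → Fin k) where

  nimAdj⇒≢ : ∀ {u w} → nimAdj Hs φ u w ≡ true → u ≢ w
  nimAdj⇒≢ {u} p refl with () ← trans (sym (cong not (==-refl u))) (proj₁ (∧-true (not (u == u)) p))

  nimAdj⇒IsNIM : ∀ {u w} → nimAdj Hs φ u w ≡ true → IsNIM Hs φ u w
  nimAdj⇒IsNIM {u} {w} p = does⇒ (isNIM? Hs φ u w) (proj₂ (∧-true (not (u == w)) p))

  InMonoCopy-sym : ∀ {H i u w} → InMonoCopy φ H i u w → InMonoCopy φ H i w u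
  InMonoCopy-sym {H} (v , inj , mono , a , b , e , p , q) = v , inj , mono , b , a , trans (Graph.sym H b a) e , q , p

  nim-sym : ∀ u w → does (isNIM? Hs φ u w) ≡ does (isNIM? Hs φ w u)
  nim-sym u w = does-⇔ (mk⇔ (λ p i → p i ∘ InMonoCopy-sym {Hs i}) (λ p i → p i ∘ InMonoCopy-sym {Hs i}))
                  (isNIM? Hs φ u w) (isNIM? Hs φ w u)

  nimAdj-sym : ∀ u w → nimAdj Hs φ u w ≡ nimAdj Hs φ w u
  nimAdj-sym u w = cong₂ (λ x y → not x ∧ y) (==-sym u w) (nim-sym u w)

  monoCopy : ∀ {H i} (g : Fin (size H) → Fin n) → Injective _≡_ _≡_ g →
    (∀ a b → adj H a b ≡ true → φ (g a) (g b) ≡ i) →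
    ∀ {a b} → adj H a b ≡ true → InMonoCopy φ H i (g a) (g b)
  monoCopy g inj mono {a} {b} e =
    tabulate g
    , (λ x y p → inj (trans (sym (lookup∘tabulate g x)) (trans p (lookup∘tabulate g y))))
    , (λ x y e → trans (cong₂ φ (lookup∘tabulate g x) (lookup∘tabulate g y)) (mono x y e))
    , a , b , e , lookup∘tabulate g a , lookup∘tabulate g b

  module _ (φ-sym : ∀ u w → φ u w ≡ φ w u) (nonBip : ∀ i → NonBipartite (Hs i)) where

    -- The colours of parts and of pairs of parts serve as `ξ₁` and `ξ₂`. The bound `m` leaves room
    -- for a whole `Hs i` in one part, and the extra 2 supplies the two vertices that define `ξ₁`.
    Homogeneous⇒Feasible : ∀ {s m} → (∀ i → size (Hs i) ≤ m) →
      Homogeneous φ (nimAdj Hs φ) s (2 + m) → Feasible Hs s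
    Homogeneous⇒Feasible {s} {m} sizes hom = ξ₁ , ξ₂ , (λ a b → φ-sym _ _) , P1 , P2
      where
      open Homogeneous hom
      ξ₁ : Fin s → Fin k
      ξ₁ a = φ (vertex a zero) (vertex a (suc zero))
      ξ₂ : Fin s → Fin s → Fin k
      ξ₂ a b = φ (vertex a zero) (vertex b zero)
      ι : ∀ {i} → Fin (size (Hs i)) → Fin (2 + m)
      ι {i} x = inject≤ x (≤-trans (sizes i) (m≤n+m m 2))
      ι-inj : ∀ {i} → Injective _≡_ _≡_ (ι {i})
      ι-inj {i} = F.inject≤-injective (≤-trans (sizes i) (m≤n+m m 2)) (≤-trans (sizes i) (m≤n+m m 2)) _ _
      disjoint : ∀ {a b i j} → a ≢ b → vertex a i ≢ vertex b j
      disjoint a≢b = nimAdj⇒≢ (cross-adj a≢b _ _)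

      P1 : ∀ i → ¬ HomToColourClass (Hs i) ξ₂ i
      P1 i (f , f-hom) with NonBipartite⇒edge (Hs i) (nonBip i)
      ... | x , y , e = nimAdj⇒IsNIM (cross-adj (proj₁ (f-hom x y e)) (ι x) (ι y)) i
              (monoCopy {Hs i} g g-inj (λ a b e → trans (cross-colour (proj₁ (f-hom a b e)) _ _ zero zero) (proj₂ (f-hom a b e))) e)
        where
        g : Fin (size (Hs i)) → Fin n
        -- Giving each vertex its own index makes the homomorphism injective inside the blow-up.
        g z = vertex (f z) (ι z)
        g-inj : Injective _≡_ _≡_ g
        g-inj {a} {b} p with f a F.≟ f b
        ... | no ¬q = contradiction p (disjoint ¬q)
        ... | yes q = ι-inj (vertex-inj (f b) (trans (cong (λ z → vertex z (ι a)) (sym q)) p))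

      P2 : ∀ a b → a ≢ b → ξ₂ a b ≢ ξ₁ a
      P2 a b a≢b eq with NonBipartite⇒edge (Hs (ξ₁ a)) (nonBip (ξ₁ a))
      ... | x , y , e = contradiction (monoCopy {Hs i} g g-inj g-mono e) (nimAdj⇒IsNIM gx-gy i)
        where
        i : Fin k
        i = ξ₁ a
        H : Graph
        H = Hs i
        -- If `ξ₂ a b` equals `ξ₁ a`, one end `x` of an edge of `H` goes to part `b` and the rest of
        -- `H` to part `a`. All edges get the colour `i`, and the edge `x y` lands on a NIM-edge.
        g : Fin (size H) → Fin n
        g z with z F.≟ x
        ... | yes _ = vertex b zero
        ... | no _  = vertex a (ι z)
        g-inj : Injective _≡_ _≡_ g
        g-inj {u} {w} p with u F.≟ x | w F.≟ x
        ... | yes q | yes r = trans q (sym r)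
        ... | yes q | no _  = contradiction (sym p) (disjoint a≢b)
        ... | no _  | yes _ = contradiction p (disjoint a≢b)
        ... | no _  | no _  = ι-inj (vertex-inj a p)
        loop : ∀ {u w} → u ≡ w → adj H u w ≢ true
        loop {u} refl e with () ← trans (sym e) (irrefl H u)
        g-mono : ∀ u w → adj H u w ≡ true → φ (g u) (g w) ≡ i
        g-mono u w e with u F.≟ x | w F.≟ x
        ... | yes q | yes r = contradiction e (loop (trans q (sym r)))
        ... | yes _ | no _  = trans (φ-sym _ _) (trans (cross-colour a≢b _ _ zero zero) eq)
        ... | no _  | yes _ = trans (cross-colour a≢b _ _ zero zero) eq
        ... | no _  | no _  = part-colour a (λ q → loop (ι-inj q) e) λ ()
        gx-gy : nimAdj Hs φ (g x) (g y) ≡ true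
        gx-gy with x F.≟ x | y F.≟ x
        ... | no ¬p | _     = contradiction refl ¬p
        ... | yes _ | yes r = contradiction e (loop (sym r))
        ... | yes _ | no _  = cross-adj (a≢b ∘ sym) _ _

-- Alignment with the Turán partition

module Alignment {n r : ℕ} (f τ : Fin n → Fin r) where

  -- Each class of `f`, pulled back along `π`, is nested with the corresponding class of `τ`, one
  -- way or the other.
  Aligned : Permutation n n → Set
  Aligned π = ∀ i → (∀ x → f (π ⟨$⟩ʳ x) ≡ i → τ x ≡ i) ⊎ (∀ y → τ y ≡ i → f (π ⟨$⟩ʳ y) ≡ i)

  mismatches : Permutation n n → ℕ
  mismatches π = ∑[ x < n ] 𝟙 (not (f (π ⟨$⟩ʳ x) == τ x))

  private
    Swappable : Permutation n n → Fin n → Fin n → Set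
    Swappable π x y = f (π ⟨$⟩ʳ x) ≢ τ x × f (π ⟨$⟩ʳ y) ≢ τ y × f (π ⟨$⟩ʳ x) ≡ τ y

    swappable? : ∀ π x y → Dec (Swappable π x y)
    swappable? π x y = ¬? (_ F.≟ _) ×-dec ¬? (_ F.≟ _) ×-dec (_ F.≟ _)

    -- After the swap `y` is well placed, and `x`, misplaced before, cannot get worse.
    swap-decreases : ∀ π x y → Swappable π x y → mismatches (transpose x y ∘ₚ π) < mismatches π
    swap-decreases π x y (x-bad , y-bad , x↦y) = ∑-mono-< pointwise y strict
      where
      pointwise : ∀ v → 𝟙 (not (f (π ⟨$⟩ʳ (transpose x y ⟨$⟩ʳ v)) == τ v)) ≤ 𝟙 (not (f (π ⟨$⟩ʳ v) == τ v))
      pointwise v with v F.≟ x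
      ... | yes refl = ≤-trans (𝟙≤1 _) (≤-reflexive (cong (𝟙 ∘ not) (sym (≢⇒==-false x-bad))))
      ... | no _ with v F.≟ y
      ...   | yes refl = ≤-trans (≤-reflexive (cong (λ z → 𝟙 (not (z == τ y))) x↦y))
                           (≤-trans (≤-reflexive (cong (𝟙 ∘ not) (==-refl (τ y)))) z≤n)
      ...   | no _     = ≤-refl
      strict : 𝟙 (not (f (π ⟨$⟩ʳ (transpose x y ⟨$⟩ʳ y)) == τ y)) < 𝟙 (not (f (π ⟨$⟩ʳ y) == τ y))
      strict with y F.≟ x
      ... | yes refl = contradiction x↦y x-bad
      ... | no _ with y F.≟ y
      ...   | no ¬p = contradiction refl ¬p
      ...   | yes _ = subst₂ (λ a b → 𝟙 (not a) < 𝟙 (not b))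
                        (sym (trans (cong (_== τ y) x↦y) (==-refl (τ y)))) (sym (≢⇒==-false y-bad)) ≤-refl

    -- A vertex `x` breaking one inclusion for class `i` and a vertex `y` breaking the other would
    -- form a swappable pair.
    stuck⇒Aligned : ∀ π → ¬ (∃₂ (Swappable π)) → Aligned π
    stuck⇒Aligned π stuck i with F.any? (λ x → (f (π ⟨$⟩ʳ x) F.≟ i) ×-dec ¬? (τ x F.≟ i))
    ... | no none = inj₁ λ x p → decidable-stable (τ x F.≟ i) λ q → none (x , p , q)
    ... | yes (x , p , q) = inj₂ λ y s → decidable-stable (f (π ⟨$⟩ʳ y) F.≟ i) λ t →
            stuck (x , y , (λ e → q (trans (sym e) p)) , (λ e → t (trans e s)) , trans p (sym s))

    improve : ∀ fuel π → mismatches π < fuel → ∃ Aligned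
    improve (suc fuel) π (s≤s le) with F.any? (λ x → F.any? (swappable? π x))
    ... | no stuck        = π , stuck⇒Aligned π stuck
    ... | yes (x , y , s) = improve fuel (transpose x y ∘ₚ π) (≤-trans (swap-decreases π x y s) le)

  align : ∃ Aligned
  align = improve (suc (mismatches Perm.id)) Perm.id ≤-refl

  excess : Permutation n n → Fin r → ℕ
  excess π i = ∑[ x < n ] (𝟙 (f (π ⟨$⟩ʳ x) == i) * 𝟙 (not (τ x == i)))

  fibre : (Fin n → Fin r) → Fin r → ℕ
  fibre g i = ∑[ x < n ] 𝟙 (g x == i)

  mismatches≡∑excess : ∀ π → mismatches π ≡ ∑[ i < r ] excess π i
  mismatches≡∑excess π = begin
    ∑[ x < n ] 𝟙 (not (g x == τ x))
      ≡⟨ ∑-cong (λ x → trans (cong (𝟙 ∘ not) (==-sym (g x) (τ x))) (sym (∑-δ (g x) (λ i → 𝟙 (not (τ x == i)))))) ⟩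
    ∑[ x < n ] ∑[ i < r ] (𝟙 (i == g x) * 𝟙 (not (τ x == i)))
      ≡⟨ ∑-cong (λ x → ∑-cong λ i → cong (λ b → 𝟙 b * 𝟙 (not (τ x == i))) (==-sym i (g x))) ⟩
    ∑[ x < n ] ∑[ i < r ] (𝟙 (g x == i) * 𝟙 (not (τ x == i)))
      ≡⟨ ∑-swap (λ x i → 𝟙 (g x == i) * 𝟙 (not (τ x == i))) ⟩
    ∑[ i < r ] excess π i ∎
    where
    open ≡-Reasoning
    g = λ x → f (π ⟨$⟩ʳ x)

  -- By nestedness the set difference is either empty or has size exactly the difference of the
  -- class sizes.
  excess-dichotomy : ∀ π → Aligned π → ∀ i → excess π i ≡ 0 ⊎ fibre f i ≡ excess π i + fibre τ i
  excess-dichotomy π aligned i with aligned i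
  ... | inj₁ h = inj₁ (trans (∑-cong pointwise) (∑-zero n))
    where
    pointwise : ∀ x → 𝟙 (f (π ⟨$⟩ʳ x) == i) * 𝟙 (not (τ x == i)) ≡ 0
    pointwise x with f (π ⟨$⟩ʳ x) F.≟ i
    ... | no _  = refl
    ... | yes p rewrite h x p | ==-refl i = refl
  ... | inj₂ h = inj₂ (begin
    fibre f i                                         ≡⟨ ∑-permute (λ x → 𝟙 (f x == i)) π ⟩
    ∑[ x < n ] 𝟙 (f (π ⟨$⟩ʳ x) == i)                  ≡⟨ ∑-cong pointwise ⟩
    ∑[ x < n ] (𝟙 (f (π ⟨$⟩ʳ x) == i) * 𝟙 (not (τ x == i)) + 𝟙 (τ x == i)) ≡⟨ ∑-+ _ _ ⟩
    excess π i + fibre τ i                            ∎)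
    where
    open ≡-Reasoning
    pointwise : ∀ x → 𝟙 (f (π ⟨$⟩ʳ x) == i) ≡ 𝟙 (f (π ⟨$⟩ʳ x) == i) * 𝟙 (not (τ x == i)) + 𝟙 (τ x == i)
    pointwise x with τ x F.≟ i
    ... | no _  = sym (trans (+-identityʳ _) (*-identityʳ _))
    ... | yes p rewrite h x p | ==-refl i = refl

∑-toℕ-+ : ∀ m n (f : ℕ → ℕ) → ∑[ x < m + n ] f (toℕ x) ≡ ∑[ x < m ] f (toℕ x) + ∑[ x < n ] f (m + toℕ x)
∑-toℕ-+ zero    n f = cong (_+ ∑[ x < n ] f (toℕ x)) (sym (∑-empty _))
∑-toℕ-+ (suc m) n f = begin
  ∑[ x < suc m + n ] f (toℕ x)                                               ≡⟨ ∑-suc {m + n} (f ∘ toℕ) ⟩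
  f 0 + ∑[ x < m + n ] f (suc (toℕ x))                                       ≡⟨ cong (f 0 +_) (∑-toℕ-+ m n (f ∘ suc)) ⟩
  f 0 + (∑[ x < m ] f (suc (toℕ x)) + ∑[ x < n ] f (suc m + toℕ x))          ≡⟨ +-assoc (f 0) _ _ ⟨
  f 0 + ∑[ x < m ] f (suc (toℕ x)) + ∑[ x < n ] f (suc m + toℕ x)            ≡⟨ cong (_+ ∑[ x < n ] f (suc m + toℕ x)) (∑-suc (f ∘ toℕ)) ⟨
  ∑[ x < suc m ] f (toℕ x) + ∑[ x < n ] f (suc m + toℕ x)                    ∎
  where open ≡-Reasoning

module _ (r′ : ℕ) where
  private
    r = suc r′

  turanClass : ∀ {n} → Fin n → Fin r
  turanClass x = fromℕ< (m%n<n (toℕ x) r)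

  private
    inClass : Fin r → ℕ → ℕ
    inClass i v = 𝟙 (fromℕ< (m%n<n v r) == i)

    inClass-periodic : ∀ i v → inClass i (r + v) ≡ inClass i v
    inClass-periodic i v = cong (λ j → 𝟙 (j == i)) (F.fromℕ<-cong _ _
      (trans (cong (_% r) (+-comm r v)) ([m+n]%n≡m%n v r)) (m%n<n (r + v) r) (m%n<n v r))

    -- Removes blocks of `r` consecutive numbers, each of which meets class `i`; an incomplete last
    -- block is covered by the summand `r`.
    large : ∀ i fuel n → n ≤ fuel → n ≤ r * ∑[ x < n ] inClass i (toℕ x) + r
    large i zero    n n≤0 = ≤-trans n≤0 z≤n
    large i (suc fuel) n n≤fuel with r ≤? n
    ... | no r≰n = ≤-trans (<⇒≤ (≰⇒> r≰n)) (m≤n+m r _)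
    ... | yes r≤n with n₁ , refl ← m≤n⇒∃[o]m+o≡n r≤n = begin
      r + n₁                                             ≤⟨ +-monoʳ-≤ r (large i fuel n₁ (≤-trans (m≤n+m n₁ r′) (s≤s⁻¹ n≤fuel))) ⟩
      r + (r * t + r)                                    ≡⟨ eq r t ⟩
      r * (1 + t) + r                                    ≤⟨ +-monoˡ-≤ r (*-monoʳ-≤ r (+-mono-≤ one (≤-reflexive (sym periodic)))) ⟩
      r * (∑[ x < r ] inClass i (toℕ x) + ∑[ x < n₁ ] inClass i (r + toℕ x)) + r
                                                         ≡⟨ cong (λ q → r * q + r) (∑-toℕ-+ r n₁ (inClass i)) ⟨
      r * ∑[ x < r + n₁ ] inClass i (toℕ x) + r          ∎
      where
      open ≤-Reasoning
      t = ∑[ x < n₁ ] inClass i (toℕ x)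
      eq : ∀ r t → r + (r * t + r) ≡ r * (1 + t) + r
      eq = solve-∀
      periodic : ∑[ x < n₁ ] inClass i (r + toℕ x) ≡ t
      periodic = ∑-cong λ x → inClass-periodic i (toℕ x)
      one : 1 ≤ ∑[ x < r ] inClass i (toℕ x)
      one = ≤-trans (≤-reflexive (sym (cong 𝟙 (trans (cong (_== i) (F.toℕ-injective
              (trans (F.toℕ-fromℕ< _) (m<n⇒m%n≡m (F.toℕ<n i))))) (==-refl i)))))
              (term≤∑ (λ x → inClass i (toℕ x)) i)

  turanClass-large : ∀ n (i : Fin r) → n ≤ r * ∑[ x < n ] 𝟙 (turanClass x == i) + r
  turanClass-large n i = large i n n ≤-refl

-- Variance of the class sizes and distance to the Turán graph

distance-square : ∀ a b → ∣ a - b ∣ * ∣ a - b ∣ + 2 * (a * b) ≡ a * a + b * b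
distance-square a b with ≤-total a b
... | inj₁ a≤b with d , refl ← m≤n⇒∃[o]m+o≡n a≤b rewrite ∣m-m+n∣≡n a d = eq a d
  where
  eq : ∀ a d → d * d + 2 * (a * (a + d)) ≡ a * a + (a + d) * (a + d)
  eq = solve-∀
... | inj₂ b≤a with d , refl ← m≤n⇒∃[o]m+o≡n b≤a rewrite ∣-∣-comm (b + d) b | ∣m-m+n∣≡n b d = eq b d
  where
  eq : ∀ b d → d * d + 2 * ((b + d) * b) ≡ (b + d) * (b + d) + b * b
  eq = solve-∀

square-cancel-≤ : ∀ {a b} → a * a ≤ b * b → a ≤ b
square-cancel-≤ {a} {b} h with a ≤? b
... | yes p = p
... | no ¬p = contradiction h (<⇒≱ (*-mono-< (≰⇒> ¬p) (≰⇒> ¬p)))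

-- The variance identity, scaled by r and with all terms moved so that no subtraction occurs.
∑-deviation : ∀ {r} n (a : Fin r → ℕ) → ∑ a ≡ n →
  ∑[ i < r ] (∣ r * a i - n ∣ * ∣ r * a i - n ∣) + r * (n * n) ≡ r * r * ∑[ i < r ] (a i * a i)
∑-deviation {r} n a ∑a≡n = +-cancelʳ-≡ (r * (n * n)) _ _ (begin
  G + r * (n * n) + r * (n * n)                                       ≡⟨ eq₁ G r n ⟩
  G + 2 * r * n * n + 0                                               ≡⟨ cong (λ q → G + 2 * r * n * q + 0) ∑a≡n ⟨
  G + 2 * r * n * ∑ a + 0                                             ≡⟨ trans (+-identityʳ _) (cong (G +_) (∑-*ˡ (2 * r * n) a)) ⟩
  G + ∑[ i < r ] (2 * r * n * a i)                                    ≡⟨ ∑-+ _ _ ⟨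
  ∑[ i < r ] (∣ r * a i - n ∣ * ∣ r * a i - n ∣ + 2 * r * n * a i)    ≡⟨ ∑-cong (λ i → trans (cong (∣ r * a i - n ∣ * ∣ r * a i - n ∣ +_) (eq₂ r n (a i)))
                                                                            (trans (distance-square (r * a i) n) (cong (_+ n * n) (eq₃ r (a i))))) ⟩
  ∑[ i < r ] (r * r * (a i * a i) + n * n)                            ≡⟨ ∑-+ _ _ ⟩
  ∑[ i < r ] (r * r * (a i * a i)) + ∑[ i < r ] (n * n)               ≡⟨ cong₂ _+_ (sym (∑-*ˡ (r * r) _)) (∑-const r (n * n)) ⟩
  r * r * ∑[ i < r ] (a i * a i) + r * (n * n)                        ∎)
  where
  open ≡-Reasoning
  G = ∑[ i < r ] (∣ r * a i - n ∣ * ∣ r * a i - n ∣)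
  eq₁ : ∀ G r n → G + r * (n * n) + r * (n * n) ≡ G + 2 * r * n * n + 0
  eq₁ = solve-∀
  eq₂ : ∀ r n a → 2 * r * n * a ≡ 2 * (r * a * n)
  eq₂ = solve-∀
  eq₃ : ∀ r a → r * a * (r * a) ≡ r * r * (a * a)
  eq₃ = solve-∀

∑-fibre-square : ∀ {n r} (c : Fin n → Fin r) →
  ∑[ x < n ] ∑[ y < n ] 𝟙 (c x == c y) ≡
  ∑[ i < r ] (∑[ x < n ] 𝟙 (c x == i) * ∑[ x < n ] 𝟙 (c x == i))
∑-fibre-square {n} {r} c = begin
  ∑[ x < n ] ∑[ y < n ] 𝟙 (c x == c y)
    ≡⟨ ∑-cong (λ x → ∑-cong λ y → trans (cong 𝟙 (==-sym (c x) (c y))) (sym (∑-δ (c x) (λ i → 𝟙 (c y == i))))) ⟩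
  ∑[ x < n ] ∑[ y < n ] ∑[ i < r ] (𝟙 (i == c x) * 𝟙 (c y == i))
    ≡⟨ ∑-cong (λ x → ∑-swap (λ y i → 𝟙 (i == c x) * 𝟙 (c y == i))) ⟩
  ∑[ x < n ] ∑[ i < r ] ∑[ y < n ] (𝟙 (i == c x) * 𝟙 (c y == i))
    ≡⟨ ∑-swap (λ x i → ∑[ y < n ] (𝟙 (i == c x) * 𝟙 (c y == i))) ⟩
  ∑[ i < r ] ∑[ x < n ] ∑[ y < n ] (𝟙 (i == c x) * 𝟙 (c y == i))
    ≡⟨ ∑-cong (λ i → trans (∑-product (λ x → 𝟙 (i == c x)) (λ y → 𝟙 (c y == i)))
         (cong (_* ∑[ y < n ] 𝟙 (c y == i)) (∑-cong λ x → cong 𝟙 (==-sym i (c x))))) ⟩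
  ∑[ i < r ] (∑[ x < n ] 𝟙 (c x == i) * ∑[ x < n ] 𝟙 (c x == i)) ∎
  where open ≡-Reasoning

-- e: ordered edges, m: edges inside classes, X: cross pairs, S: pairs inside classes, G: total squared
-- deviation of the class sizes, d: missing cross pairs.
module Balance (r′ K N e m X S G d : ℕ)
  (pairs   : X + S ≡ N)
  (missing : X + m ≡ d + e)
  (squares : G + suc r′ * N ≡ suc r′ * suc r′ * S)
  (partition : K * (e + m) ≤ K * X + N)
  (dense   : K * r′ * N ≤ K * suc r′ * e + suc r′ * N) where

  open ≤-Reasoning
  private
    r = suc r′

  -- The sum of `r` times `dense`, `r * r` times `partition` and `K` times `squares`. The terms in
  -- `e`, `X` and `S` cancel through `pairs`, so `m` and `G` are bounded together.
  r²Km+KG≤2r²N : r * r * (K * m) + K * G ≤ r * r * (2 * N)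
  r²Km+KG≤2r²N = +-cancelʳ-≤ (K * r * N + K * r′ * r * N + K * r * e * r) _ _ (begin
    r * r * (K * m) + K * G + (K * r * N + K * r′ * r * N + K * r * e * r)
      ≡⟨ eq₁ r r′ K m G N e ⟩
    K * r′ * N * r + r * r * (K * (e + m)) + K * (G + r * N)
      ≤⟨ +-mono-≤ (+-mono-≤ (*-monoˡ-≤ r dense) (*-monoʳ-≤ (r * r) partition)) (*-monoʳ-≤ K (≤-reflexive squares)) ⟩
    (K * r * e + r * N) * r + r * r * (K * X + N) + K * (r * r * S)
      ≡⟨ eq₂ r K e N X S ⟩
    r * r * (2 * N) + r * r * K * (X + S) + K * r * e * r
      ≡⟨ cong (λ q → r * r * (2 * N) + r * r * K * q + K * r * e * r) pairs ⟩
    r * r * (2 * N) + r * r * K * N + K * r * e * r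
      ≡⟨ eq₃ r′ K N e ⟩
    r * r * (2 * N) + (K * r * N + K * r′ * r * N + K * r * e * r) ∎)
    where
    eq₁ : ∀ r r′ K m G N e → r * r * (K * m) + K * G + (K * r * N + K * r′ * r * N + K * r * e * r) ≡
      K * r′ * N * r + r * r * (K * (e + m)) + K * (G + r * N)
    eq₁ = solve-∀
    eq₂ : ∀ r K e N X S → (K * r * e + r * N) * r + r * r * (K * X + N) + K * (r * r * S) ≡
      r * r * (2 * N) + r * r * K * (X + S) + K * r * e * r
    eq₂ = solve-∀
    eq₃ : ∀ r′ K N e → (1 + r′) * (1 + r′) * (2 * N) + (1 + r′) * (1 + r′) * K * N + K * (1 + r′) * e * (1 + r′) ≡
      (1 + r′) * (1 + r′) * (2 * N) + (K * (1 + r′) * N + K * r′ * (1 + r′) * N + K * (1 + r′) * e * (1 + r′))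
    eq₃ = solve-∀

  KG≤2r²N : K * G ≤ r * r * (2 * N)
  KG≤2r²N = ≤-trans (m≤n+m _ _) r²Km+KG≤2r²N

  Km≤2N : K * m ≤ 2 * N
  Km≤2N = *-cancelˡ-≤ (r * r) (≤-trans (m≤m+n _ _) r²Km+KG≤2r²N)

  N≤rS : N ≤ r * S
  N≤rS = *-cancelˡ-≤ r (≤-trans (m≤n+m (r * N) G) (≤-reflexive (trans squares (*-assoc r r S))))

  -- As `N ≤ r * S`, at most `(1 - 1/r) N` pairs are cross pairs, while `dense` gives `e` at least
  -- `(1 - 1/r) N - N / K`. Hence `d = X + m - e` is at most `m + N / K`.
  Kd≤3N : K * d ≤ 3 * N
  Kd≤3N = *-cancelˡ-≤ r (+-cancelʳ-≤ (K * r * e + K * N) _ _ (begin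
    r * (K * d) + (K * r * e + K * N)       ≡⟨ eq₁ r K d e N ⟩
    r * K * (d + e) + K * N                 ≡⟨ cong (λ q → r * K * q + K * N) missing ⟨
    r * K * (X + m) + K * N                 ≤⟨ +-monoʳ-≤ (r * K * (X + m)) (*-monoʳ-≤ K N≤rS) ⟩
    r * K * (X + m) + K * (r * S)           ≡⟨ eq₂ r K X m S ⟩
    r * K * (X + S) + r * (K * m)           ≡⟨ cong (λ q → r * K * q + r * (K * m)) pairs ⟩
    r * K * N + r * (K * m)                 ≡⟨ cong (_+ r * (K * m)) (eq₃ r′ K N) ⟩
    K * r′ * N + K * N + r * (K * m)        ≤⟨ +-mono-≤ (+-monoˡ-≤ (K * N) dense) (*-monoʳ-≤ r Km≤2N) ⟩
    K * r * e + r * N + K * N + r * (2 * N) ≡⟨ eq₄ r K e N ⟩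
    r * (3 * N) + (K * r * e + K * N)       ∎))
    where
    eq₁ : ∀ r K d e N → r * (K * d) + (K * r * e + K * N) ≡ r * K * (d + e) + K * N
    eq₁ = solve-∀
    eq₂ : ∀ r K X m S → r * K * (X + m) + K * (r * S) ≡ r * K * (X + S) + r * (K * m)
    eq₂ = solve-∀
    eq₃ : ∀ r′ K N → (1 + r′) * K * N ≡ K * r′ * N + K * N
    eq₃ = solve-∀
    eq₄ : ∀ r K e N → K * r * e + r * N + K * N + r * (2 * N) ≡ r * (3 * N) + (K * r * e + K * N)
    eq₄ = solve-∀

  K[m+d]≤5N : K * (m + d) ≤ 5 * N
  K[m+d]≤5N = begin
    K * (m + d)        ≡⟨ *-distribˡ-+ K m d ⟩
    K * m + K * d      ≤⟨ +-mono-≤ Km≤2N Kd≤3N ⟩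
    2 * N + 3 * N      ≡⟨ *-distribʳ-+ N 2 3 ⟨
    5 * N              ∎

module _ {n : ℕ} (1≤n : 1 ≤ n) (adj : Fin n → Fin n → Bool) (adj-sym : ∀ x y → adj x y ≡ adj y x) where
  open Partition 1≤n adj adj-sym using (weight; cross)

  private
    N : ℕ
    N = n * n
    all : Subset {n}
    all _ = true

  edges : ℕ
  edges = ∑[ x < n ] ∑[ y < n ] 𝟙 (adj x y)

  module _ (L r′ : ℕ) (1≤L : 1 ≤ L) (L≤n : L ≤ n) (c : Fin n → Fin (suc r′))
    (partition : 2 * (L * L) * weight all c ≤ 2 * (L * L) * cross all c + N)
    (dense : 2 * (L * L) * r′ * N ≤ 2 * (L * L) * suc r′ * edges + suc r′ * N) where

    private
      r K : ℕ
      r = suc r′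
      K = 2 * (L * L)
      open Alignment c (turanClass r′ {n})
      a : Fin r → ℕ
      a = fibre c
      mono miss X S G : ℕ
      mono = ∑[ x < n ] ∑[ y < n ] (𝟙 (adj x y) * 𝟙 (c x == c y))
      miss = ∑[ x < n ] ∑[ y < n ] (𝟙 (not (c x == c y)) * 𝟙 (not (adj x y)))
      X    = ∑[ x < n ] ∑[ y < n ] 𝟙 (not (c x == c y))
      S    = ∑[ x < n ] ∑[ y < n ] 𝟙 (c x == c y)
      G    = ∑[ i < r ] (∣ r * a i - n ∣ * ∣ r * a i - n ∣)

      ∑∑-+ : ∀ (f g h : Fin n → Fin n → ℕ) → (∀ x y → h x y ≡ f x y + g x y) →
        ∑[ x < n ] ∑[ y < n ] h x y ≡ ∑[ x < n ] ∑[ y < n ] f x y + ∑[ x < n ] ∑[ y < n ] g x y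
      ∑∑-+ f g h eq = trans (∑-cong λ x → trans (∑-cong (eq x)) (∑-+ (f x) (g x))) (∑-+ (λ x → ∑ (f x)) (λ x → ∑ (g x)))

      weight≡ : weight all c ≡ edges + mono
      weight≡ = ∑∑-+ _ _ _ λ x y → eq (𝟙 (adj x y)) (𝟙 (c x == c y))
        where eq : ∀ u v → (1 * 1) * (u * (1 + v)) ≡ u + u * v
              eq = solve-∀

      cross≡ : cross all c ≡ X
      cross≡ = ∑-cong λ x → ∑-cong λ y → +-identityʳ _

      pairs : X + S ≡ N
      pairs = trans (sym (∑∑-+ _ _ (λ _ _ → 1) λ x y → eq (c x == c y)))
        (trans (∑-cong λ _ → trans (∑-const n 1) (*-identityʳ n)) (∑-const n n))
        where eq : ∀ b → 1 ≡ 𝟙 (not b) + 𝟙 b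
              eq false = refl
              eq true  = refl

      missing : X + mono ≡ miss + edges
      missing = trans (sym (∑∑-+ _ _ (λ x y → 𝟙 (not (c x == c y)) + 𝟙 (adj x y) * 𝟙 (c x == c y)) λ _ _ → refl))
        (∑∑-+ _ _ _ λ x y → eq (c x == c y) (adj x y))
        where eq : ∀ b e → 𝟙 (not b) + 𝟙 e * 𝟙 b ≡ 𝟙 (not b) * 𝟙 (not e) + 𝟙 e
              eq false false = refl
              eq false true  = refl
              eq true  false = refl
              eq true  true  = refl

      squares : G + r * N ≡ r * r * S
      squares = trans (∑-deviation n a (∑-fibres c)) (cong (r * r *_) (sym (∑-fibre-square c)))

      open Balance r′ K N edges mono X S G miss pairs missing squares
        (subst₂ (λ w x → K * w ≤ K * x + N) weight≡ cross≡ partition) dense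

      -- The choice `K = 2 * (L * L)` makes both sides of `KG≤2r²N` twice a perfect square, so the
      -- root can be taken in the natural numbers.
      deviation-bound : ∀ i → L * ∣ r * a i - n ∣ ≤ r * n
      deviation-bound i = square-cancel-≤ (*-cancelˡ-≤ 2 (begin
        2 * ((L * g) * (L * g))     ≡⟨ eq₁ L g ⟩
        K * (g * g)                 ≤⟨ *-monoʳ-≤ K (term≤∑ (λ i → ∣ r * a i - n ∣ * ∣ r * a i - n ∣) i) ⟩
        K * G                       ≤⟨ KG≤2r²N ⟩
        r * r * (2 * (n * n))       ≡⟨ eq₂ r n ⟩
        2 * ((r * n) * (r * n))     ∎))
        where
        open ≤-Reasoning
        g = ∣ r * a i - n ∣
        eq₁ : ∀ L g → 2 * ((L * g) * (L * g)) ≡ 2 * (L * L) * (g * g)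
        eq₁ = solve-∀
        eq₂ : ∀ r n → r * r * (2 * (n * n)) ≡ 2 * ((r * n) * (r * n))
        eq₂ = solve-∀

      excess-bound : ∀ π → Aligned π → ∀ i → L * excess π i ≤ 2 * n
      excess-bound π aligned i with excess-dichotomy π aligned i
      ... | inj₁ e≡0 = ≤-trans (≤-reflexive (trans (cong (L *_) e≡0) (*-zeroʳ L))) z≤n
      ... | inj₂ a≡  = *-cancelˡ-≤ r (begin
        r * (L * excess π i)       ≡⟨ eq₁ r L (excess π i) ⟩
        L * (r * excess π i)       ≤⟨ *-monoʳ-≤ L (+-cancelʳ-≤ n _ _ excess≤) ⟩
        L * (g + r)                ≡⟨ *-distribˡ-+ L g r ⟩
        -- Here `L ≤ n` absorbs the rounding error `r` in the size of a Turán class.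
        L * g + L * r              ≤⟨ +-mono-≤ (deviation-bound i) (*-monoˡ-≤ r L≤n) ⟩
        r * n + n * r              ≡⟨ eq₂ r n ⟩
        r * (2 * n)                ∎)
        where
        open ≤-Reasoning
        g = ∣ r * a i - n ∣
        t = fibre (turanClass r′) i
        eq₁ : ∀ r L e → r * (L * e) ≡ L * (r * e)
        eq₁ = solve-∀
        eq₂ : ∀ r n → r * n + n * r ≡ r * (2 * n)
        eq₂ = solve-∀
        eq₃ : ∀ r e t → r * e + (r * t + r) ≡ r * (e + t) + r
        eq₃ = solve-∀
        eq₄ : ∀ n g r → n + g + r ≡ g + r + n
        eq₄ = solve-∀
        excess≤ : r * excess π i + n ≤ g + r + n
        excess≤ = begin
          r * excess π i + n             ≤⟨ +-monoʳ-≤ (r * excess π i) (turanClass-large r′ n i) ⟩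
          r * excess π i + (r * t + r)   ≡⟨ eq₃ r (excess π i) t ⟩
          r * (excess π i + t) + r       ≡⟨ cong (λ q → r * q + r) a≡ ⟨
          r * a i + r                    ≤⟨ +-monoˡ-≤ r (m≤n+∣m-n∣ (r * a i) n) ⟩
          n + g + r                      ≡⟨ eq₄ n g r ⟩
          g + r + n                      ∎

      mismatch-bound : ∀ π → Aligned π → L * mismatches π ≤ r * (2 * n)
      mismatch-bound π aligned = begin
        L * mismatches π                   ≡⟨ cong (L *_) (mismatches≡∑excess π) ⟩
        L * ∑ (excess π)                   ≡⟨ ∑-*ˡ L (excess π) ⟩
        ∑[ i < r ] (L * excess π i)        ≤⟨ ∑-mono (excess-bound π aligned) ⟩
        ∑[ i < r ] (2 * n)                 ≡⟨ ∑-const r (2 * n) ⟩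
        r * (2 * n)                        ∎
        where open ≤-Reasoning

      L≤K : L ≤ K
      L≤K = ≤-trans (m≤m*n L L {{>-nonZero 1≤L}}) (m≤n*m (L * L) 2)

    turanDistance : Permutation n n → ℕ
    turanDistance π = ∑[ x < n ] ∑[ y < n ]
      𝟙 (adj (π ⟨$⟩ʳ x) (π ⟨$⟩ʳ y) xor not (turanClass r′ x == turanClass r′ y))

    private
      -- If both ends are well placed, a disagreement is an edge inside a class or a missing cross
      -- edge; otherwise it is charged to a misplaced end.
      xor-pointwise : ∀ {i j k l : Fin r} e →
        𝟙 (e xor not (k == l)) ≤ 𝟙 e * 𝟙 (i == j) + 𝟙 (not (i == j)) * 𝟙 (not e) + (𝟙 (not (i == k)) + 𝟙 (not (j == l)))
      xor-pointwise {i} {j} {k} {l} e with i F.≟ k | j F.≟ l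
      ... | no _ | _    = ≤-trans (𝟙≤1 _) (≤-trans (m≤m+n 1 _) (m≤n+m _ (𝟙 e * 𝟙 (i == j) + 𝟙 (not (i == j)) * 𝟙 (not e))))
      ... | yes _ | no _ = ≤-trans (𝟙≤1 _) (m≤n+m _ (𝟙 e * 𝟙 (i == j) + 𝟙 (not (i == j)) * 𝟙 (not e)))
      ... | yes refl | yes refl = ≤-trans (eq e (i == j)) (≤-reflexive (sym (+-identityʳ _)))
        where eq : ∀ e b → 𝟙 (e xor not b) ≤ 𝟙 e * 𝟙 b + 𝟙 (not b) * 𝟙 (not e)
              eq false false = ≤-refl
              eq false true  = ≤-refl
              eq true  false = ≤-refl
              eq true  true  = ≤-refl

      ∑∑-permute : ∀ (f : Fin n → Fin n → ℕ) π →
        ∑[ x < n ] ∑[ y < n ] f (π ⟨$⟩ʳ x) (π ⟨$⟩ʳ y) ≡ ∑[ x < n ] ∑[ y < n ] f x y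
      ∑∑-permute f π = trans (∑-cong λ x → sym (∑-permute (f (π ⟨$⟩ʳ x)) π)) (sym (∑-permute (λ x → ∑ (f x)) π))

      distance-bound : ∀ π → turanDistance π ≤ mono + miss + (n * mismatches π + n * mismatches π)
      distance-bound π = begin
        turanDistance π
          ≤⟨ ∑-mono (λ x → ∑-mono λ y → xor-pointwise {c (π ⟨$⟩ʳ x)} {c (π ⟨$⟩ʳ y)} (adj (π ⟨$⟩ʳ x) (π ⟨$⟩ʳ y))) ⟩
        ∑[ x < n ] ∑[ y < n ] (f x y + g x y + (h x + h y))
          ≡⟨ ∑∑-+³ f g (λ x y → h x + h y) ⟩
        ∑[ x < n ] ∑[ y < n ] f x y + ∑[ x < n ] ∑[ y < n ] g x y + ∑[ x < n ] ∑[ y < n ] (h x + h y)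
          ≡⟨ cong₂ _+_ (cong₂ _+_ (∑∑-permute f₀ π) (∑∑-permute g₀ π))
               (∑∑-+ (λ x y → h x) (λ x y → h y) (λ x y → h x + h y) λ _ _ → refl) ⟩
        mono + miss + (∑[ x < n ] ∑[ y < n ] h x + ∑[ x < n ] ∑[ y < n ] h y)
          ≡⟨ cong (mono + miss +_) (cong₂ _+_ (trans (∑-cong λ x → ∑-const n (h x)) (sym (∑-*ˡ n h))) (∑-const n (∑ h))) ⟩
        mono + miss + (n * mismatches π + n * mismatches π) ∎
        where
        open ≤-Reasoning
        f₀ g₀ f g : Fin n → Fin n → ℕ
        f₀ x y = 𝟙 (adj x y) * 𝟙 (c x == c y)
        g₀ x y = 𝟙 (not (c x == c y)) * 𝟙 (not (adj x y))
        f x y = f₀ (π ⟨$⟩ʳ x) (π ⟨$⟩ʳ y)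
        g x y = g₀ (π ⟨$⟩ʳ x) (π ⟨$⟩ʳ y)
        h : Fin n → ℕ
        h x = 𝟙 (not (c (π ⟨$⟩ʳ x) == turanClass r′ x))

    -- The 5 pays for inner and missing edges. The `4 * r` arises from at most `2 * r * n / L`
    -- misplaced vertices, each charged `n` pairs in either coordinate.
    partition⇒near-turán : Σ (Permutation n n) λ π → L * turanDistance π ≤ (5 + 4 * r) * N
    partition⇒near-turán with align
    ... | π , aligned = π , (begin
      L * turanDistance π                                                    ≤⟨ *-monoʳ-≤ L (distance-bound π) ⟩
      L * (mono + miss + (n * mismatches π + n * mismatches π))              ≡⟨ eq₁ L (mono + miss) n (mismatches π) ⟩
      L * (mono + miss) + 2 * n * (L * mismatches π)                         ≤⟨ +-mono-≤ (≤-trans (*-monoˡ-≤ (mono + miss) L≤K) K[m+d]≤5N)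
                                                                                  (*-monoʳ-≤ (2 * n) (mismatch-bound π aligned)) ⟩
      5 * N + 2 * n * (r * (2 * n))                                          ≡⟨ eq₂ n r ⟩
      (5 + 4 * r) * N                                                        ∎)
      where
      open ≤-Reasoning
      eq₁ : ∀ L q n m → L * (q + (n * m + n * m)) ≡ L * q + 2 * n * (L * m)
      eq₁ = solve-∀
      eq₂ : ∀ n r → 5 * (n * n) + 2 * n * (r * (2 * n)) ≡ (5 + 4 * r) * (n * n)
      eq₂ = solve-∀

-- Rational bounds

-- Both `ℕ→ℚ` and the fractions `1 / suc d` are values of `fromℚᵘ` by definition, so their
-- arithmetic can be done on unnormalised fractions.
fromℚᵘ-homo-+ : ∀ p q → fromℚᵘ (p ℚᵘ.+ q) ≡ fromℚᵘ p ℚ.+ fromℚᵘ q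
fromℚᵘ-homo-+ p q = ℚ.toℚᵘ-injective (ℚᵘ.≃-trans (ℚ.toℚᵘ-fromℚᵘ _) (ℚᵘ.≃-sym (ℚᵘ.≃-trans
  (ℚ.toℚᵘ-homo-+ (fromℚᵘ p) (fromℚᵘ q)) (ℚᵘ.+-cong (ℚ.toℚᵘ-fromℚᵘ p) (ℚ.toℚᵘ-fromℚᵘ q)))))

fromℚᵘ-homo-* : ∀ p q → fromℚᵘ (p ℚᵘ.* q) ≡ fromℚᵘ p ℚ.* fromℚᵘ q
fromℚᵘ-homo-* p q = ℚ.toℚᵘ-injective (ℚᵘ.≃-trans (ℚ.toℚᵘ-fromℚᵘ _) (ℚᵘ.≃-sym (ℚᵘ.≃-trans
  (ℚ.toℚᵘ-homo-* (fromℚᵘ p) (fromℚᵘ q)) (ℚᵘ.*-cong (ℚ.toℚᵘ-fromℚᵘ p) (ℚ.toℚᵘ-fromℚᵘ q)))))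

ℕ→ℚ-+ : ∀ a b → ℕ→ℚ (a + b) ≡ ℕ→ℚ a ℚ.+ ℕ→ℚ b
ℕ→ℚ-+ a b = trans (ℚ.fromℚᵘ-cong {mkℚᵘ (ℤ.+ (a + b)) 0} {mkℚᵘ (ℤ.+ a) 0 ℚᵘ.+ mkℚᵘ (ℤ.+ b) 0} (*≡* (cong (ℤ._* ℤ.+ 1) (sym (cong₂ ℤ._+_ (ℤ.*-identityʳ (ℤ.+ a)) (ℤ.*-identityʳ (ℤ.+ b)))))))
  (fromℚᵘ-homo-+ (mkℚᵘ (ℤ.+ a) 0) (mkℚᵘ (ℤ.+ b) 0))

ℕ→ℚ-* : ∀ a b → ℕ→ℚ (a * b) ≡ ℕ→ℚ a ℚ.* ℕ→ℚ b
ℕ→ℚ-* a b = trans (ℚ.fromℚᵘ-cong {mkℚᵘ (ℤ.+ (a * b)) 0} {mkℚᵘ (ℤ.+ a) 0 ℚᵘ.* mkℚᵘ (ℤ.+ b) 0} (*≡* (cong (ℤ._* ℤ.+ 1) (ℤ.pos-* a b))))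
  (fromℚᵘ-homo-* (mkℚᵘ (ℤ.+ a) 0) (mkℚᵘ (ℤ.+ b) 0))

ℕ→ℚ-cancel-≤ : ∀ {a b} → ℕ→ℚ a ℚ.≤ ℕ→ℚ b → a ≤ b
ℕ→ℚ-cancel-≤ {a} {b} h with ℚᵘ.≤-respˡ-≃ (ℚ.toℚᵘ-fromℚᵘ (mkℚᵘ (ℤ.+ a) 0))
                              (ℚᵘ.≤-respʳ-≃ (ℚ.toℚᵘ-fromℚᵘ (mkℚᵘ (ℤ.+ b) 0)) (ℚ.toℚᵘ-mono-≤ h))
... | *≤* q = ℤ.drop‿+≤+ (subst₂ ℤ._≤_ (ℤ.*-identityʳ (ℤ.+ a)) (ℤ.*-identityʳ (ℤ.+ b)) q)

ℕ→ℚ-nonNeg : ∀ a → ℚ.NonNegative (ℕ→ℚ a)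
ℕ→ℚ-nonNeg a = ℚ.normalize-nonNeg a 1

inverse-* : ∀ d → (ℤ.+ 1) ℚ./ suc d ℚ.* ℕ→ℚ (suc d) ≡ 1ℚ
inverse-* d = trans (sym (fromℚᵘ-homo-* (mkℚᵘ (ℤ.+ 1) d) (mkℚᵘ (ℤ.+ suc d) 0)))
  (ℚ.fromℚᵘ-cong {mkℚᵘ (ℤ.+ 1) d ℚᵘ.* mkℚᵘ (ℤ.+ suc d) 0} {mkℚᵘ (ℤ.+ 1) 0} (*≡* (cong ℤ.+_ (eq d))))
  where
  eq : ∀ d → (1 * suc d) * 1 ≡ 1 * (suc d * 1)
  eq = solve-∀

-- The density hypothesis multiplied by 2 r K, where δ = 1 / 2K.
clear-denominators : ∀ r′ K d N m → suc d ≡ 2 * K →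
  oneMinusInv (suc r′) ℚ.* ℕ→ℚ N ℚ.* ½ ℚ.- (ℤ.+ 1) ℚ./ suc d ℚ.* ℕ→ℚ N ℚ.≤ ℕ→ℚ m →
  K * r′ * N ≤ K * suc r′ * (2 * m) + suc r′ * N
clear-denominators r′ K d N m d≡2K h = ℕ→ℚ-cancel-≤ (begin
  ℕ→ℚ (K * r′ * N)                                       ≡⟨ trans (ℕ→ℚ-* (K * r′) N) (cong (ℚ._* ν) (ℕ→ℚ-* K r′)) ⟩
  κ ℚ.* ρ ℚ.* ν                                          ≡⟨ rearrange ⟩
  c ℚ.* ((1ℚ ℚ.- i) ℚ.* ν ℚ.* ½ ℚ.- δ ℚ.* ν) ℚ.+ R ℚ.* ν ≤⟨ ℚ.+-monoˡ-≤ (R ℚ.* ν) (ℚ.*-monoˡ-≤-nonNeg c {{ℕ→ℚ-nonNeg (2 * K * suc r′)}} h) ⟩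
  c ℚ.* ℕ→ℚ m ℚ.+ R ℚ.* ν                                ≡⟨ cong₂ ℚ._+_ (ℕ→ℚ-* (2 * K * suc r′) m) (ℕ→ℚ-* (suc r′) N) ⟨
  ℕ→ℚ (2 * K * suc r′ * m) ℚ.+ ℕ→ℚ (suc r′ * N)          ≡⟨ ℕ→ℚ-+ (2 * K * suc r′ * m) (suc r′ * N) ⟨
  ℕ→ℚ (2 * K * suc r′ * m + suc r′ * N)                  ≡⟨ cong (λ q → ℕ→ℚ (q + suc r′ * N)) (eq K (suc r′) m) ⟩
  ℕ→ℚ (K * suc r′ * (2 * m) + suc r′ * N)                ∎)
  where
  open ℚ.≤-Reasoning
  ν κ ρ R i δ c : ℚ
  ν = ℕ→ℚ N
  κ = ℕ→ℚ K
  ρ = ℕ→ℚ r′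
  R = ℕ→ℚ (suc r′)
  i = (ℤ.+ 1) ℚ./ suc r′
  δ = (ℤ.+ 1) ℚ./ suc d
  c = ℕ→ℚ (2 * K * suc r′)
  eq : ∀ K r m → 2 * K * r * m ≡ K * r * (2 * m)
  eq = solve-∀
  Δ : ℚ
  Δ = ℕ→ℚ (2 * K)
  δΔ≡1 : δ ℚ.* Δ ≡ 1ℚ
  δΔ≡1 = trans (cong (λ q → δ ℚ.* ℕ→ℚ q) (sym d≡2K)) (inverse-* d)
  Δ½≡κ : Δ ℚ.* ½ ≡ κ
  Δ½≡κ = trans (cong (ℚ._* ½) (ℕ→ℚ-* 2 K)) (trans (ℚ.*-comm (ℕ→ℚ 2 ℚ.* κ) ½)
           (trans (sym (ℚ.*-assoc ½ (ℕ→ℚ 2) κ)) (ℚ.*-identityˡ κ)))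
  rearrange : κ ℚ.* ρ ℚ.* ν ≡ c ℚ.* ((1ℚ ℚ.- i) ℚ.* ν ℚ.* ½ ℚ.- δ ℚ.* ν) ℚ.+ R ℚ.* ν
  rearrange = sym (begin-equality
    c ℚ.* ((1ℚ ℚ.- i) ℚ.* ν ℚ.* ½ ℚ.- δ ℚ.* ν) ℚ.+ R ℚ.* ν
      ≡⟨ cong (λ q → q ℚ.* ((1ℚ ℚ.- i) ℚ.* ν ℚ.* ½ ℚ.- δ ℚ.* ν) ℚ.+ R ℚ.* ν) (ℕ→ℚ-* (2 * K) (suc r′)) ⟩
    Δ ℚ.* R ℚ.* ((1ℚ ℚ.- i) ℚ.* ν ℚ.* ½ ℚ.- δ ℚ.* ν) ℚ.+ R ℚ.* ν
      -- The regrouping isolates the products `D :* h`, `i :* R` and `δ :* D`, the only places where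
      -- a fraction meets its denominator; they are evaluated in the next step.
      ≡⟨ solve 6 (λ D R i ν h δ → D :* R :* ((con 1ℚ :- i) :* ν :* h :- δ :* ν) :+ R :* ν :=
           (D :* h) :* ν :* (R :- i :* R) :+ (con 1ℚ :- δ :* D) :* (R :* ν)) refl Δ R i ν ½ δ ⟩
    (Δ ℚ.* ½) ℚ.* ν ℚ.* (R ℚ.- i ℚ.* R) ℚ.+ (1ℚ ℚ.- δ ℚ.* Δ) ℚ.* (R ℚ.* ν)
      ≡⟨ cong₂ (λ x y → x ℚ.+ (1ℚ ℚ.- y) ℚ.* (R ℚ.* ν)) (cong₂ (λ x y → x ℚ.* ν ℚ.* y) Δ½≡κ
           (cong₂ ℚ._-_ (ℕ→ℚ-+ 1 r′) (inverse-* r′))) δΔ≡1 ⟩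
    κ ℚ.* ν ℚ.* ((1ℚ ℚ.+ ρ) ℚ.- 1ℚ) ℚ.+ (1ℚ ℚ.- 1ℚ) ℚ.* (R ℚ.* ν)
      ≡⟨ solve 4 (λ κ ν ρ R → κ :* ν :* ((con 1ℚ :+ ρ) :- con 1ℚ) :+ (con 1ℚ :- con 1ℚ) :* (R :* ν) := κ :* ρ :* ν) refl κ ν ρ R ⟩
    κ ℚ.* ρ ℚ.* ν ∎)
    where open +-*-Solver

-- A positive rational has numerator at least 1, so it is at least the reciprocal of its
-- denominator.
ε-bound : ∀ ε → 0ℚ ℚ.< ε → ∀ a N → suc (ℚ.ℚ.denominator-1 ε) * a ≤ N → ℕ→ℚ a ℚ.≤ ε ℚ.* ℕ→ℚ N
ε-bound (mkℚ (ℤ.+ zero) d c) (ℚ.*<* (ℤ.+<+ ())) a N h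
ε-bound (mkℚ ℤ.-[1+ p ] d c) (ℚ.*<* ()) a N h
ε-bound ε@(mkℚ (ℤ.+ suc p) d c) _ a N h = ℚ.toℚᵘ-cancel-≤
  (ℚᵘ.≤-respˡ-≃ (ℚᵘ.≃-sym (ℚ.toℚᵘ-fromℚᵘ (mkℚᵘ (ℤ.+ a) 0)))
  (ℚᵘ.≤-respʳ-≃ (ℚᵘ.≃-sym (ℚᵘ.≃-trans (ℚ.toℚᵘ-homo-* ε (ℕ→ℚ N)) (ℚᵘ.*-congˡ {toℚᵘ ε} (ℚ.toℚᵘ-fromℚᵘ (mkℚᵘ (ℤ.+ N) 0)))))
  (*≤* (begin
    ℤ.+ a ℤ.* ℤ.+ (suc d * 1)             ≡⟨ ℤ.pos-* a (suc d * 1) ⟨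
    ℤ.+ (a * (suc d * 1))                 ≤⟨ ℤ.+≤+ (≤-trans (≤-reflexive (eq a (suc d))) (≤-trans h (m≤m*n N (suc p)))) ⟩
    ℤ.+ (N * suc p)                       ≡⟨ cong ℤ.+_ (*-comm N (suc p)) ⟩
    ℤ.+ (suc p * N)                       ≡⟨ ℤ.pos-* (suc p) N ⟩
    ℤ.+ suc p ℤ.* ℤ.+ N                   ≡⟨ ℤ.*-identityʳ _ ⟨
    ℤ.+ suc p ℤ.* ℤ.+ N ℤ.* ℤ.+ 1         ∎))))
  where
  open ℤ.≤-Reasoning
  eq : ∀ a d → a * (d * 1) ≡ d * a
  eq = solve-∀

-- List counts as double sums

sum-concatMap-tabulate : ∀ {A : Set} {n} (g : A → List.List ℕ) (h : Fin n → A) →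
  listSum (List.concatMap g (List.tabulate h)) ≡ ∑[ x < n ] listSum (g (h x))
sum-concatMap-tabulate {n = zero}  g h = sym (∑-empty _)
sum-concatMap-tabulate {n = suc n} g h = begin
  listSum (g (h zero) List.++ List.concatMap g (List.tabulate (h ∘ suc)))
    ≡⟨ sum-++ (g (h zero)) _ ⟩
  listSum (g (h zero)) + listSum (List.concatMap g (List.tabulate (h ∘ suc)))
    ≡⟨ cong (listSum (g (h zero)) +_) (sum-concatMap-tabulate g (h ∘ suc)) ⟩
  listSum (g (h zero)) + ∑[ x < n ] listSum (g (h (suc x)))
    ≡⟨ ∑-suc (λ x → listSum (g (h x))) ⟨
  ∑[ x < suc n ] listSum (g (h x)) ∎
  where open ≡-Reasoning

countPairs≡∑ : ∀ n b → countPairs n b ≡ ∑[ u < n ] ∑[ w < n ] 𝟙 (does (u F.<? w) ∧ b u w)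
countPairs≡∑ n b = begin
  countPairs n b
    ≡⟨ sum-concatMap-tabulate {n = n} (λ u → List.concatMap (λ w → entry u w List.∷ List.[]) (List.allFin n)) id ⟩
  ∑[ u < n ] listSum (List.concatMap (λ w → entry u w List.∷ List.[]) (List.allFin n))
    ≡⟨ ∑-cong (λ u → sum-concatMap-tabulate (λ w → entry u w List.∷ List.[]) id) ⟩
  ∑[ u < n ] ∑[ w < n ] (entry u w + 0)
    ≡⟨ ∑-cong (λ u → ∑-cong λ w → +-identityʳ _) ⟩
  ∑[ u < n ] ∑[ w < n ] entry u w ∎
  where
  open ≡-Reasoning
  entry : Fin n → Fin n → ℕ
  entry u w = 𝟙 (does (u F.<? w) ∧ b u w)

-- Stability for NIM-graphs

countPairs-sym : ∀ n (b : Fin n → Fin n → Bool) → (∀ u w → b u w ≡ b w u) →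
  2 * countPairs n b ≤ ∑[ u < n ] ∑[ w < n ] 𝟙 (not (u == w) ∧ b u w)
countPairs-sym n b b-sym = begin
  2 * countPairs n b                                                      ≡⟨ cong (2 *_) (countPairs≡∑ n b) ⟩
  2 * P                                                                   ≡⟨ cong (P +_) (+-identityʳ P) ⟩
  P + P                                                                   ≡⟨ cong (P +_) (∑-swap (λ u w → 𝟙 (does (u F.<? w) ∧ b u w))) ⟩
  P + ∑[ u < n ] ∑[ w < n ] 𝟙 (does (w F.<? u) ∧ b w u)                   ≡⟨ ∑-+ _ _ ⟨
  ∑[ u < n ] (∑[ w < n ] 𝟙 (does (u F.<? w) ∧ b u w) + ∑[ w < n ] 𝟙 (does (w F.<? u) ∧ b w u))
                                                                          ≡⟨ ∑-cong (λ u → ∑-+ _ _) ⟨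
  ∑[ u < n ] ∑[ w < n ] (𝟙 (does (u F.<? w) ∧ b u w) + 𝟙 (does (w F.<? u) ∧ b w u))
                                                                          ≤⟨ ∑-mono (λ u → ∑-mono λ w → pointwise u w) ⟩
  ∑[ u < n ] ∑[ w < n ] 𝟙 (not (u == w) ∧ b u w)                          ∎
  where
  open ≤-Reasoning
  P = ∑[ u < n ] ∑[ w < n ] 𝟙 (does (u F.<? w) ∧ b u w)
  exclusive : ∀ {A B C : Set} (p : Dec A) (q : Dec B) (e : Dec C) x → (A → ¬ B) → (A → ¬ C) → (B → ¬ C) →
    𝟙 (does p ∧ x) + 𝟙 (does q ∧ x) ≤ 𝟙 (not (does e) ∧ x)
  exclusive (yes a) (yes b) _       x     ab ac bc = contradiction b (ab a)
  exclusive (yes a) (no _)  (yes c) x     ab ac bc = contradiction c (ac a)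
  exclusive (yes a) (no _)  (no _)  x     ab ac bc = ≤-reflexive (+-identityʳ (𝟙 x))
  exclusive (no _)  (yes b) (yes c) x     ab ac bc = contradiction c (bc b)
  exclusive (no _)  (yes b) (no _)  x     ab ac bc = ≤-refl
  exclusive (no _)  (no _)  _       x     ab ac bc = z≤n
  pointwise : ∀ u w → 𝟙 (does (u F.<? w) ∧ b u w) + 𝟙 (does (w F.<? u) ∧ b w u) ≤ 𝟙 (not (u == w) ∧ b u w)
  pointwise u w = subst (λ z → 𝟙 (does (u F.<? w) ∧ b u w) + 𝟙 (does (w F.<? u) ∧ z) ≤ 𝟙 (not (u == w) ∧ b u w)) (b-sym u w)
    (exclusive (u F.<? w) (w F.<? u) (u F.≟ w) (b u w) (λ p q → <-asym p q) F.<⇒≢ (λ q → F.<⇒≢ q ∘ sym))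

turanAdj≡ : ∀ {n} r′ (x y : Fin n) → turanAdj n (suc r′) x y ≡ not (turanClass r′ x == turanClass r′ y)
turanAdj≡ r′ x y = cong not (does-⇔ (mk⇔
  (λ e → F.fromℕ<-cong _ _ e (m%n<n (toℕ x) (suc r′)) (m%n<n (toℕ y) (suc r′)))
  (λ e → trans (sym (F.toℕ-fromℕ< _)) (trans (cong toℕ e) (F.toℕ-fromℕ< _))))
  (toℕ x % suc r′ ≟ toℕ y % suc r′) (turanClass r′ x F.≟ turanClass r′ y))

-- Passing to all ordered pairs only adds terms. For `x < y` the diagonal guard in `nimAdj` is true
-- because `π` is injective.
nimTuranDiff≤ : ∀ {k n} r′ (Hs : Fin k → Graph) (φ : Fin n → Fin n → Fin k) (π : Permutation n n) →
  nimTuranDiff n (suc r′) Hs φ (π ⟨$⟩ʳ_) ≤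
  ∑[ x < n ] ∑[ y < n ] 𝟙 (nimAdj Hs φ (π ⟨$⟩ʳ x) (π ⟨$⟩ʳ y) xor not (turanClass r′ x == turanClass r′ y))
nimTuranDiff≤ {k} {n} r′ Hs φ π = ≤-trans (≤-reflexive (countPairs≡∑ n _)) (∑-mono λ x → ∑-mono λ y → pointwise x y)
  where
  drop : ∀ {A B C : Set} (p : Dec A) (e : Dec B) x {t t′} → (A → ¬ B) → t ≡ t′ →
    𝟙 (does p ∧ (x xor t)) ≤ 𝟙 ((not (does e) ∧ x) xor t′)
  drop (no _)  _       x ab eq   = z≤n
  drop (yes a) (yes b) x ab eq   = contradiction b (ab a)
  drop (yes a) (no _)  x ab refl = ≤-refl
  pointwise : ∀ x y → 𝟙 (does (x F.<? y) ∧ (does (isNIM? Hs φ (π ⟨$⟩ʳ x) (π ⟨$⟩ʳ y)) xor turanAdj n (suc r′) x y)) ≤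
    𝟙 (nimAdj Hs φ (π ⟨$⟩ʳ x) (π ⟨$⟩ʳ y) xor not (turanClass r′ x == turanClass r′ y))
  pointwise x y = drop {C = Fin 0} (x F.<? y) (_ F.≟ _) (does (isNIM? Hs φ (π ⟨$⟩ʳ x) (π ⟨$⟩ʳ y)))
    (λ x<y e → F.<⇒≢ x<y (Bijection.injective (↔⇒⤖ π) e)) (turanAdj≡ r′ x y)

-- Rules out `r* = 0` when there is a colour: one vertex offers no pair to which an edge of `Hs i`
-- could be mapped.
feasible-1 : ∀ {k} (Hs : Fin (suc k) → Graph) → (∀ i → NonBipartite (Hs i)) → Feasible Hs 1
feasible-1 Hs nonBip = (λ _ → zero) , (λ _ _ → zero) , (λ _ _ → refl)
  , (λ { i (f , hom) → let a , b , e = NonBipartite⇒edge (Hs i) (nonBip i)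
                       in proj₁ (hom a b e) (Fin1-unique (f a) (f b)) })
  , λ a b a≢b _ → a≢b (Fin1-unique a b)
  where
  Fin1-unique : (a b : Fin 1) → a ≡ b
  Fin1-unique zero zero = refl

few-nim-cliques : ∀ {k n} (Hs : Fin k → Graph) → (∀ i → NonBipartite (Hs i)) → ∀ {r} → IsRStar Hs r →
  (φ : Fin n → Fin n → Fin k) → (∀ u w → φ u w ≡ φ w u) → 1 ≤ k → ∀ C →
  blowupThreshold (suc r) (blowupSize k (suc r) (2 + ∑[ i < k ] size (Hs i))) C ≤ n →
  C * Cliques.cliques (nimAdj Hs φ) (suc r) (λ _ → true) ≤ n ^ suc r
few-nim-cliques {k} {n} Hs nonBip {r} (_ , maximal) φ φ-sym 1≤k C large
  with n ^ suc r ≤? C * Cliques.cliques (nimAdj Hs φ) (suc r) (λ _ → true)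
... | no sparse = <⇒≤ (≰⇒> sparse)
... | yes many  = contradiction (maximal (suc r) feasible) (<⇒≱ (n<1+n r))
  where
  m = ∑[ i < k ] size (Hs i)
  feasible : Feasible Hs (suc r)
  feasible = Homogeneous⇒Feasible Hs φ φ-sym nonBip (term≤∑ (size ∘ Hs))
    (Blowup⇒Homogeneous φ φ-sym (nimAdj Hs φ) (nimAdj-sym Hs φ) 1≤k (suc r) (2 + m)
      (dense⇒Blowup (nimAdj Hs φ) (suc r) _ C large (λ _ → true) many))

near-turán : ∀ {k} (Hs : Fin k → Graph) → (∀ i → NonBipartite (Hs i)) → ∀ r′ → IsRStar Hs (suc r′) →
  ∀ L → 1 ≤ L → Σ ℕ λ n₀ → ∀ n → n ≥ n₀ → (φ : Fin n → Fin n → Fin k) → (∀ u w → φ u w ≡ φ w u) →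
  2 * (L * L) * r′ * (n * n) ≤ 2 * (L * L) * suc r′ * (2 * nim n Hs φ) + suc r′ * (n * n) →
  Σ (Permutation n n) λ π → L * nimTuranDiff n (suc r′) Hs φ (π ⟨$⟩ʳ_) ≤ (5 + 4 * suc r′) * (n * n)
near-turán {k} Hs nonBip r′ isR L 1≤L = L ⊔ threshold , stable
  where
  K C threshold : ℕ
  K = 2 * (L * L)
  C = partitionDensity r′ K
  threshold = blowupThreshold (2 + r′) (blowupSize k (2 + r′) (2 + ∑[ i < k ] size (Hs i))) C
  Fin⇒1≤ : ∀ {k} → Fin k → 1 ≤ k
  Fin⇒1≤ zero    = s≤s z≤n
  Fin⇒1≤ (suc _) = s≤s z≤n
  stable : ∀ n → n ≥ L ⊔ threshold → (φ : Fin n → Fin n → Fin k) → (∀ u w → φ u w ≡ φ w u) →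
    K * r′ * (n * n) ≤ K * suc r′ * (2 * nim n Hs φ) + suc r′ * (n * n) →
    Σ (Permutation n n) λ π → L * nimTuranDiff n (suc r′) Hs φ (π ⟨$⟩ʳ_) ≤ (5 + 4 * suc r′) * (n * n)
  stable n large φ φ-sym dense = π , ≤-trans (*-monoʳ-≤ L (nimTuranDiff≤ r′ Hs φ π)) near
    where
    L≤n : L ≤ n
    L≤n = ≤-trans (m≤m⊔n L threshold) large
    1≤n : 1 ≤ n
    1≤n = ≤-trans 1≤L L≤n
    adjᴺ = nimAdj Hs φ
    symᴺ = nimAdj-sym Hs φ
    -- Any vertex will do: `φ v v` witnesses that there is at least one colour.
    v : Fin n
    v = F.fromℕ< 1≤n
    dense′ : K * r′ * (n * n) ≤ K * suc r′ * edges 1≤n adjᴺ symᴺ + suc r′ * (n * n)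
    dense′ = ≤-trans dense (+-monoˡ-≤ (suc r′ * (n * n)) (*-monoʳ-≤ (K * suc r′)
      (countPairs-sym n (λ u w → does (isNIM? Hs φ u w)) (nim-sym Hs φ))))
    parts = Partition.few-cliques⇒partition 1≤n adjᴺ symᴺ r′ K (λ _ → true)
      (few-nim-cliques Hs nonBip isR φ φ-sym (Fin⇒1≤ (φ v v)) C (≤-trans (m≤n⊔m L threshold) large))
    result = partition⇒near-turán 1≤n adjᴺ symᴺ L r′ 1≤L L≤n (proj₁ parts) (proj₂ parts) dense′
    π = proj₁ result
    near = proj₂ result

theorem1p6 : ∀ {k} (Hs : Fin k → Graph) → (∀ i → NonBipartite (Hs i)) →
    (r : ℕ) → IsRStar Hs r →
    (ε : ℚ) → 0ℚ ℚ.< ε →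
    Σ ℚ λ δ → (0ℚ ℚ.< δ) × Σ ℕ λ n₀ → ∀ n → n ≥ n₀ →
    (φ : Fin n → Fin n → Fin k) → (∀ u w → φ u w ≡ φ w u) →
    (oneMinusInv r ℚ.* ℕ→ℚ (n Data.Nat.* n) ℚ.* ½ ℚ.- δ ℚ.* ℕ→ℚ (n Data.Nat.* n))
    ℚ.≤ ℕ→ℚ (nim n Hs φ) →
    Σ (Fin n → Fin n) λ σ → Bijective _≡_ _≡_ σ ×
    (ℕ→ℚ (nimTuranDiff n r Hs φ σ) ℚ.≤ ε ℚ.* ℕ→ℚ (n Data.Nat.* n))
-- Without colours no colouring of a nonempty vertex set exists, so `n₀ = 1` makes the claim
-- vacuous.
theorem1p6 {zero} Hs nonBip zero isR ε ε>0 =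
  1ℚ , ℚ.positive⁻¹ 1ℚ , 1 , λ { (suc n) _ φ _ _ → contradiction (φ zero zero) λ () }
theorem1p6 {suc k} Hs nonBip zero (_ , maximal) ε ε>0 = contradiction (maximal 1 (feasible-1 Hs nonBip)) λ ()
theorem1p6 {k} Hs nonBip (suc r′) isR ε ε>0 =
  δ , ℚ.positive⁻¹ δ {{ℚ.normalize-pos 1 (suc d)}} , n₀ , λ n large φ φ-sym dense →
    let π , near = stable n large φ φ-sym (clear-denominators r′ (2 * (L * L)) d (n * n) (nim n Hs φ) refl dense)
        diff = nimTuranDiff n (suc r′) Hs φ (π ⟨$⟩ʳ_)
    in π ⟨$⟩ʳ_ , Bijection.bijective (↔⇒⤖ π) ,
       ε-bound ε ε>0 diff (n * n) (*-cancelˡ-≤ (5 + 4 * suc r′) (≤-trans (≤-reflexive (eq (5 + 4 * suc r′) E diff)) near))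
  where
  E L d : ℕ
  E = suc (ℚ.ℚ.denominator-1 ε)
  -- Chosen so that cancelling `5 + 4 * suc r′` in `near` leaves `E * diff ≤ n * n`, with `E` the
  -- denominator of `ε`. Then `δ` is `1 / 2K` for `K = 2 * (L * L)`, and `d` is the predecessor of
  -- that denominator.
  L = E * (5 + 4 * suc r′)
  d = pred (2 * (2 * (L * L)))
  δ : ℚ
  δ = (ℤ.+ 1) ℚ./ suc d
  n₀ = proj₁ (near-turán Hs nonBip r′ isR L (s≤s z≤n))
  stable = proj₂ (near-turán Hs nonBip r′ isR L (s≤s z≤n))
  eq : ∀ c E x → c * (E * x) ≡ E * c * x
  eq = solve-∀
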